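{- Let $s\ge1$, let $\beta_1,\dotsc,\beta_s$ be positive integers, $|\boldsymbol\beta|=\beta_1+\dotsb+\beta_s$, and let $n$ be a positive integer. Consider the expansion of \[ F_{\boldsymbol\beta,q}[s;1]=\prod_{1\le i<j\le s}\Big(\frac{z_i}{z_j};q\Big)_{\beta_i}\Big(\frac{qz_j}{z_i};q\Big)_{\beta_j}\prod_{i=1}^s\Big(\frac{z_i}{w_1};q\Big)_{\beta_i}^{ -1}. \] Then the monomial $z_1^{k_1}z_2^{k_2}\dotsm z_s^{k_s}/w_1^n$ does not appear in this expansion if $k_i<n$ for all $i=1,\dotsc,s$. Moreover, for each $a\in\{1,\dotsc,s\}$, the coefficient of $z_a^n/w_1^n$ in this expansion is \[ q^{\sum_{j=a+1}^s\beta_j}\frac{(1-q^{\beta_a})(q;q)_{|\boldsymbol\beta|-\beta_a}}{(q;q)_{\beta_1}(q;q)_{\beta_2}\dotsm(q;q)_{\beta_s}}\,(q^{|\boldsymbol\beta|-\beta_a+n+1};q)_{\beta_a-1}. \]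
   Context: $(z;q)_n=(1-z)(1-qz)\dotsm(1-q^{n-1}z)$, $(z;q)_0=1$. The expansion is the formal series obtained by expanding each factor $(1-q^bz_i/w_1)^{ -1}$ as $\sum_{m\ge0}(q^bz_i/w_1)^m$ (i.e. in the region $|q^bz_i/w_1|<1$), the other factors being Laurent polynomials in the $z_i$. -}

module Defs where

open import Algebra.Bundles using (CommutativeRing)
open import Algebra.Bundles.Raw using (RawRing)
import Algebra.Definitions
import Algebra.Definitions.RawSemiring
open import Data.Bool.Base using (if_then_else_)
open import Data.Fin.Base using (Fin; toℕ)
open import Data.Fin.Properties using (_<?_)
open import Data.Integer.Base using (ℤ; +_; -[1+_])
import Data.Integer.Base as ℤ
import Data.Integer.Properties as ℤₚ
open import Data.List.Base using (List; []; _∷_; _++_; map; foldr; cartesianProductWith)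
open import Data.Nat.Base using (ℕ; zero; suc; _∸_)
import Data.Nat.Base as ℕ
open import Data.Product.Base using (_×_; _,_; proj₁)
open import Data.Vec.Base using (Vec; replicate; zipWith; _[_]≔_)
import Data.Vec.Properties as Vecₚ
open import Level using (Level)
open import Relation.Nullary.Decidable.Core using (does)

private
  variable
    c ℓ : Level

module QPochhammer (A : RawRing c ℓ) where
  open RawRing A
  open Algebra.Definitions.RawSemiring rawSemiring using (_^_)

  -- ⟨ z ︔ q ⟩ n is (z;q)_n = (1 - z)(1 - qz)⋯(1 - q^{n-1}z).
  ⟨_︔_⟩_ : Carrier → Carrier → ℕ → Carrier
  ⟨ z ︔ q ⟩ zero  = 1#
  ⟨ z ︔ q ⟩ suc n = (⟨ z ︔ q ⟩ n) * (1# + - (q ^ n * z))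

-- Formal power series, with the Cauchy product; f n is the n-th coefficient.
powerSeries : RawRing c ℓ → RawRing c ℓ
powerSeries A = record
  { Carrier = ℕ → Carrier
  ; _≈_     = λ f g → ∀ n → f n ≈ g n
  ; _+_     = λ f g n → f n + g n
  ; _*_     = λ f g n → sum {suc n} λ i → f (toℕ i) * g (n ∸ toℕ i)
  ; -_      = λ f n → - f n
  ; 0#      = λ _ → 0#
  ; 1#      = λ { zero → 1# ; (suc _) → 0# }
  }
  where
  open RawRing A
  open Algebra.Definitions.RawSemiring rawSemiring using (sum)

-- Laurent polynomials in z₁,…,z_s over R.  A polynomial is a finite formal sum
-- of terms (r , e) standing for r·z^e; exponents may repeat, and equality is
-- equality of all coefficients.
module Laurent (R : CommutativeRing c ℓ) (s : ℕ) where
  open CommutativeRing R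

  Exponent : Set
  Exponent = Vec ℤ s

  Term : Set c
  Term = Carrier × Exponent

  infixl 7 _·_
  _·_ : Term → Term → Term
  (r , e) · (r′ , e′) = r * r′ , zipWith ℤ._+_ e e′

  coefficient : List Term → Exponent → Carrier
  coefficient p k =
    foldr (λ { (r , e) x → (if does (Vecₚ.≡-dec ℤₚ._≟_ e k) then r else 0#) + x }) 0# p

  constant : Carrier → List Term
  constant r = (r , replicate s (+ 0)) ∷ []

  laurent : RawRing c ℓ
  laurent = record
    { Carrier = List Term
    ; _≈_     = λ p p′ → ∀ k → coefficient p k ≈ coefficient p′ k
    ; _+_     = _++_
    ; _*_     = cartesianProductWith _·_
    ; -_      = map λ { (r , e) → - r , e }
    ; 0#      = []
    ; 1#      = constant 1#
    }

  -- The exponent of z_a^m.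
  power : Fin s → ℤ → Exponent
  power a m = replicate s (+ 0) [ a ]≔ m

  var : Fin s → List Term
  var i = (1# , power i (+ 1)) ∷ []

  var⁻¹ : Fin s → List Term
  var⁻¹ i = (1# , power i -[1+ 0 ]) ∷ []

module Expansion (R : CommutativeRing c ℓ) (q : CommutativeRing.Carrier R)
                 (s : ℕ) (β : Fin s → ℕ) where
  open Laurent R s

  private
    module L = RawRing laurent
    module L^ = Algebra.Definitions.RawSemiring L.rawSemiring

  -- Series in w₁⁻¹ over the Laurent polynomials in the z_i.
  series : RawRing _ _
  series = powerSeries laurent

  open RawRing series
  open Algebra.Definitions.RawSemiring rawSemiring using (product)
  open QPochhammer laurent

  embed : L.Carrier → Carrier
  embed p zero    = p
  embed p (suc _) = L.0#

  -- (1 - x/w₁)⁻¹ expanded as Σ_{m≥0} (x/w₁)^m.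
  geometric : L.Carrier → Carrier
  geometric x m = x L^.^ m

  qL : L.Carrier
  qL = constant q

  -- The product over 1 ≤ i < j ≤ s.
  laurentFactor : L.Carrier
  laurentFactor =
    L^.product λ i → L^.product λ j →
      if does (i <? j)
      then (⟨ var i L.* var⁻¹ j ︔ qL ⟩ β i) L.* (⟨ qL L.* (var j L.* var⁻¹ i) ︔ qL ⟩ β j)
      else L.1#

  -- The product over i of (z_i/w₁;q)_{β_i}⁻¹.
  inverseFactor : Carrier
  inverseFactor =
    product λ i → product {β i} λ b → geometric ((qL L^.^ toℕ b) L.* var i)

  F : Carrier
  F = embed laurentFactor * inverseFactor

  -- [z^ k /w^ n ]F is the coefficient of z₁^{k₁}⋯z_s^{k_s}/w₁ⁿ in F.
  [z^_/w^_]F : Exponent → ℕ → CommutativeRing.Carrier R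
  [z^ k /w^ n ]F = coefficient (F n) k

module Weights {s : ℕ} (β : Fin s → ℕ) where
  open Algebra.Definitions.RawSemiring ℕ.+-*-rawSemiring using (sum)

  ∣β∣ : ℕ
  ∣β∣ = sum β

  -- Σ_{j=a+1}^s β_j
  tailSum : Fin s → ℕ
  tailSum a = sum λ j → if does (a <? j) then β j else 0

module RingNotation (R : CommutativeRing c ℓ) where
  open CommutativeRing R public using (_≈_; _*_; _-_; 0#; 1#; rawRing)
  open Algebra.Definitions.RawSemiring (RawRing.rawSemiring rawRing) public using (_^_; product)
  open QPochhammer rawRing public

  IsUnit : CommutativeRing.Carrier R → Set _
  IsUnit = Algebra.Definitions.Invertible _≈_ 1# _*_

  infixl 7 _÷_[_]
  _÷_[_] : CommutativeRing.Carrier R → (y : CommutativeRing.Carrier R) → IsUnit y → CommutativeRing.Carrier R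
  x ÷ y [ u ] = x * proj₁ u

{-# OPTIONS --safe #-}
module Submission where

-- Put u_{i,b} = q^b z_i.  The coefficient of w₁⁻ⁿ in ∏ (z_i/w₁;q)_{β_i}⁻¹ is the
-- complete symmetric polynomial h_n(u), and by partial fractions
--   h_n(u) = ∑_{a,b} u_{a,b}ⁿ ∏_{(j,c)≠(a,b)} (1 - u_{j,c}/u_{a,b})⁻¹.
-- After multiplication by the Laurent factor all poles in the z's cancel, and for
-- j ≠ a what remains of the pair {a,j} is a polynomial in z_a/z_j.  Hence the
-- summand (a,b) is divisible by z_aⁿ, which gives the vanishing; its coefficient
-- of z_aⁿ is a constant times the constant term of the Laurent factor in the
-- variables other than z_a.  The case n = 0 of the same computation proves the
-- q-Dyson identity for that constant term by induction on the number of variables.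
--
-- This needs q and all 1 - q^e to be invertible.  Both claims are identities
-- between integer polynomials in q, so it suffices to have them at q = 2, 3, 4, …
-- over ℚ; they then hold for every q in every commutative ring.

open import Defs
open import Algebra.Bundles using (CommutativeMonoid; CommutativeRing; RawRing)
import Algebra.Construct.Pointwise
import Algebra.Definitions.RawMonoid
import Algebra.Definitions.RawSemiring
import Algebra.Properties.CommutativeMonoid.Sum
import Algebra.Properties.CommutativeSemigroup
import Algebra.Properties.CommutativeSemiring.Exp
import Algebra.Properties.Group
import Algebra.Properties.Ring
import Algebra.Properties.Semiring.Exp
import Algebra.Properties.Semiring.Mult
import Algebra.Properties.Semiring.Sum
import Algebra.Solver.Ring.NaturalCoefficients.Default
open import Data.Bool.Base using (Bool; true; false; if_then_else_)
open import Data.Empty using (⊥-elim)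
open import Data.Fin.Base using (Fin; toℕ; zero; suc)
import Data.Fin.Base as Fin
import Data.Fin.Properties as Fin
open import Data.Integer.Base using (ℤ; +_; -[1+_])
import Data.Integer.Base as ℤ
import Data.Integer.Properties as ℤ
open import Data.List.Base using (List; []; _∷_; _++_; map; foldr; concatMap; filter; upTo; applyUpTo; tabulate; allFin; length)
import Data.List.Properties as List
open import Data.List.Membership.Propositional using (_∈_; find; lose)
open import Data.List.Membership.Propositional.Properties using (∈-allFin; ∈-concatMap⁺; ∈-concatMap⁻; ∈-filter⁻; ∈-map⁺; ∈-map⁻; ∈-upTo⁺; ∈-upTo⁻)
open import Data.List.Relation.Binary.Pointwise using (Pointwise; []; _∷_)
import Data.List.Relation.Binary.Pointwise as Pointwise
open import Data.List.Relation.Unary.All as All using (All; []; _∷_)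
import Data.List.Relation.Unary.All.Properties as All
open import Data.List.Relation.Unary.AllPairs as AllPairs using (AllPairs; []; _∷_)
import Data.List.Relation.Unary.AllPairs.Properties as AllPairs
open import Data.List.Relation.Unary.Any using (here; there)
open import Data.List.Relation.Unary.Unique.Propositional using (Unique)
import Data.List.Relation.Unary.Unique.Propositional.Properties as Unique
open import Data.Nat.Base using (ℕ; zero; suc; _∸_; _≤_; _<_; s≤s; z≤n; _%_)
import Data.Nat.Base as ℕ
import Data.Nat.DivMod as ℕ
import Data.Nat.Properties as ℕ
open import Data.Product.Base using (_×_; _,_; proj₁; proj₂; Σ; ∃-syntax)
import Data.Product.Properties as Product
open import Data.Rational.Base using (ℚ; 0ℚ; 1ℚ)
import Data.Rational.Base as ℚ
import Data.Rational.Properties as ℚ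
open import Data.Vec.Base using (Vec; []; _∷_; replicate; zipWith; lookup; _[_]≔_)
import Data.Vec.Properties as Vec
open import Function.Base using (_∘_; id)
open import Function.Bundles using (mk⇔)
open import Level using (_⊔_) renaming (suc to lsuc)
open import Relation.Binary.Definitions using (DecidableEquality; Tri; tri<; tri≈; tri>)
open import Relation.Binary.PropositionalEquality as ≡ using (_≡_; _≢_)
import Relation.Binary.Reasoning.Setoid
open import Relation.Nullary.Decidable using (Dec; does; yes; no; ¬?; dec-true; dec-false; does-⇔)
open import Relation.Nullary.Negation using (¬_)

-- Partial fractions are needed in the ring of Laurent polynomials, where neither u_k - u_l nor 1 -
-- u_l/u_k is invertible in general. They are therefore stated with weights G_k such that G_k
-- ∏_{l≠k} (1 - u_l/u_k) is the same L for every k, and the proof uses only that u_k - u_l is not a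
-- zero divisor. For L the Laurent factor such weights exist, because each pair {a,j} contains all
-- the zeros required. At z_a = 0 the polynomial left over from {a,j} takes the value q^{β_j b} if j
-- < a and q^{β_j (b+1)} if j > a. This shift is the origin of the power of q with exponent ∑_{j>a}
-- β_j. The sum over b that remains is a partial fraction sum once more, now for the constants 1, q,
-- ..., q^{β_a-1}: it is the Gaussian binomial coefficient h_M(1, ..., q^{β_a-1}) with M = |β| - β_a
-- + n, and multiplied by (q;q)_{β_a} it becomes (1 - q^{β_a}) (q^{M+1};q)_{β_a-1}. The passage to
-- arbitrary rings rests on a logical relation: the same operations build the coefficients over both
-- rings, so corresponding coefficients are values of one integer polynomial.

if-yes : ∀ {a p} {X : Set a} {P : Set p} (P? : Dec P) → P → {x y : X} → (if does P? then x else y) ≡ x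
if-yes P? p {x} {y} = ≡.cong (if_then x else y) (dec-true P? p)

if-no : ∀ {a p} {X : Set a} {P : Set p} (P? : Dec P) → ¬ P → {x y : X} → (if does P? then x else y) ≡ y
if-no P? ¬p {x} {y} = ≡.cong (if_then x else y) (dec-false P? ¬p)

-- Finite lists: removal of an element, folds in a commutative monoid.

module Without {a} {X : Set a} (_≟_ : DecidableEquality X) where

  without : X → List X → List X
  without x = filter (λ y → ¬? (y ≟ x))

  without-∉ : ∀ {x xs} → All (x ≢_) xs → without x xs ≡ xs
  without-∉ {x} all≢ = List.filter-all (λ y → ¬? (y ≟ x)) (All.map (λ x≢y → x≢y ∘ ≡.sym) all≢)

module ListFold {c ℓ} (M : CommutativeMonoid c ℓ) where
  open CommutativeMonoid M
  open Algebra.Properties.CommutativeSemigroup commutativeSemigroup using (interchange; x∙yz≈y∙xz)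
  open Algebra.Definitions.RawMonoid rawMonoid using (sum)

  fold : ∀ {a} {X : Set a} → (X → Carrier) → List X → Carrier
  fold f []       = ε
  fold f (x ∷ xs) = f x ∙ fold f xs

  module _ {a} {X : Set a} where

    fold-cong : ∀ {f g : X → Carrier} xs → (∀ {x} → x ∈ xs → f x ≈ g x) → fold f xs ≈ fold g xs
    fold-cong []       f≈g = refl
    fold-cong (x ∷ xs) f≈g = ∙-cong (f≈g (here ≡.refl)) (fold-cong xs (f≈g ∘ there))

    fold-∙ : ∀ (f g : X → Carrier) xs → fold (λ x → f x ∙ g x) xs ≈ fold f xs ∙ fold g xs
    fold-∙ f g []       = sym (identityˡ ε)
    fold-∙ f g (x ∷ xs) = trans (∙-congˡ (fold-∙ f g xs)) (interchange _ _ _ _)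

    fold-ε : ∀ (xs : List X) → fold (λ _ → ε) xs ≈ ε
    fold-ε []       = refl
    fold-ε (x ∷ xs) = trans (identityˡ _) (fold-ε xs)

    fold-++ : ∀ (f : X → Carrier) xs ys → fold f (xs ++ ys) ≈ fold f xs ∙ fold f ys
    fold-++ f []       ys = sym (identityˡ _)
    fold-++ f (x ∷ xs) ys = trans (∙-congˡ (fold-++ f xs ys)) (sym (assoc _ _ _))

  fold-map : ∀ {a b} {X : Set a} {Y : Set b} (f : Y → Carrier) (g : X → Y) xs →
             fold f (map g xs) ≈ fold (f ∘ g) xs
  fold-map f g []       = refl
  fold-map f g (x ∷ xs) = ∙-congˡ (fold-map f g xs)

  fold-concatMap : ∀ {a b} {X : Set a} {Y : Set b} (f : Y → Carrier) (g : X → List Y) xs →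
                   fold f (concatMap g xs) ≈ fold (λ x → fold f (g x)) xs
  fold-concatMap f g []       = refl
  fold-concatMap f g (x ∷ xs) =
    trans (fold-++ f (g x) (concatMap g xs)) (∙-congˡ (fold-concatMap f g xs))

  fold-tabulate : ∀ {a} {X : Set a} {n} (f : X → Carrier) (t : Fin n → X) → sum (f ∘ t) ≈ fold f (tabulate t)
  fold-tabulate {n = zero}  f t = refl
  fold-tabulate {n = suc n} f t = ∙-congˡ (fold-tabulate f (t ∘ suc))

  module _ {a} {X : Set a} (_≟_ : DecidableEquality X) where
    open Without _≟_

    fold-without : ∀ (f : X → Carrier) {x xs} → Unique xs → x ∈ xs → fold f xs ≈ f x ∙ fold f (without x xs)
    fold-without f {x} {_ ∷ xs} (x∉xs ∷ _) (here ≡.refl) =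
      ∙-congˡ (reflexive (≡.cong (fold f) (≡.sym (≡.trans
        (List.filter-reject (λ y → ¬? (y ≟ x)) (λ x≢x → x≢x ≡.refl)) (without-∉ x∉xs)))))
    fold-without f {x} {y ∷ xs} (y∉xs ∷ unique) (there x∈xs) = trans
      (∙-congˡ (fold-without f unique x∈xs))
      (trans (x∙yz≈y∙xz _ _ _) (∙-congˡ (reflexive (≡.cong (fold f) (≡.sym
        (List.filter-accept (λ y → ¬? (y ≟ x)) (All.lookup y∉xs x∈xs)))))))

-- Ring identities and complete homogeneous symmetric polynomials.

module RingLemmas {c ℓ} (A : CommutativeRing c ℓ) where
  open CommutativeRing A hiding (zero)
  open Algebra.Properties.Ring ring public using (-‿distribˡ-*; -‿distribʳ-*; -0#≈0#; -‿+-comm; -‿involutive; +-cancelˡ; +-cancelʳ)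
  open Algebra.Properties.Group +-group public using () renaming (x∙y⁻¹≈ε⇒x≈y to x-y≈0⇒x≈y)
  open Algebra.Properties.Semiring.Exp semiring public using (_^_; ^-congˡ; ^-congʳ; ^-homo-*; ^-assocʳ)
  open Algebra.Properties.CommutativeSemiring.Exp commutativeSemiring public using (^-distrib-*)
  open Algebra.Solver.Ring.NaturalCoefficients.Default commutativeSemiring public using (solve; _:=_; _:*_; _:+_; con)
  open Algebra.Properties.CommutativeSemigroup *-commutativeSemigroup public using (interchange; x∙yz≈y∙xz; xy∙z≈xz∙y; xy∙z≈y∙xz)
  open Relation.Binary.Reasoning.Setoid setoid public

  module Sum = ListFold +-commutativeMonoid
  module Prod = ListFold *-commutativeMonoid

  ∑ : ∀ {a} {X : Set a} → (X → Carrier) → List X → Carrier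
  ∑ = Sum.fold

  ∏ : ∀ {a} {X : Set a} → (X → Carrier) → List X → Carrier
  ∏ = Prod.fold

  ∑-distribˡ : ∀ {a} {X : Set a} x (f : X → Carrier) xs → x * ∑ f xs ≈ ∑ (λ y → x * f y) xs
  ∑-distribˡ x f []       = zeroʳ x
  ∑-distribˡ x f (y ∷ ys) = trans (distribˡ x _ _) (+-congˡ (∑-distribˡ x f ys))

  ^-sum : ∀ {a} {X : Set a} x (f : X → ℕ) xs →
          ∏ (λ y → x ^ f y) xs ≈ x ^ ListFold.fold ℕ.+-0-commutativeMonoid f xs
  ^-sum x f []       = refl
  ^-sum x f (y ∷ ys) = trans (*-congˡ (^-sum x f ys)) (sym (^-homo-* x (f y) _))

  1^n≈1 : ∀ n → 1# ^ n ≈ 1#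
  1^n≈1 zero    = refl
  1^n≈1 (suc n) = trans (*-identityˡ _) (1^n≈1 n)

  ^-swap : ∀ x m n → (x ^ m) ^ n ≈ (x ^ n) ^ m
  ^-swap x m n = trans (^-assocʳ x m n) (trans (^-congʳ x (ℕ.*-comm m n)) (sym (^-assocʳ x n m)))

  inverse-^ : ∀ {x y} → x * y ≈ 1# → ∀ n → x ^ n * y ^ n ≈ 1#
  inverse-^ {x} {y} xy≈1 n =
    trans (sym (^-distrib-* x y n)) (trans (^-congˡ n xy≈1) (1^n≈1 n))

  unit-cancel : ∀ {x y z} → x * y ≈ 1# → x * z ≈ 0# → z ≈ 0#
  unit-cancel {x} {y} {z} xy≈1 xz≈0 = begin
    z            ≈⟨ *-identityˡ z ⟨
    1# * z       ≈⟨ *-congʳ xy≈1 ⟨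
    x * y * z    ≈⟨ xy∙z≈y∙xz x y z ⟩
    y * (x * z)  ≈⟨ *-congˡ xz≈0 ⟩
    y * 0#       ≈⟨ zeroʳ y ⟩
    0#           ∎

  1-x*y : ∀ x y → (1# - x) * y + x * y ≈ y
  1-x*y x y = begin
    (1# - x) * y + x * y  ≈⟨ distribʳ y _ _ ⟨
    (1# - x + x) * y      ≈⟨ *-congʳ (trans (+-assoc _ _ _) (trans (+-congˡ (-‿inverseˡ x)) (+-identityʳ _))) ⟩
    1# * y                ≈⟨ *-identityˡ y ⟩
    y                     ∎

  -x*-y≈x*y : ∀ x y → - x * - y ≈ x * y
  -x*-y≈x*y x y = begin
    - x * - y      ≈⟨ -‿distribˡ-* x (- y) ⟨
    - (x * - y)    ≈⟨ -‿cong (-‿distribʳ-* x y) ⟨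
    - (- (x * y))  ≈⟨ -‿involutive (x * y) ⟩
    x * y          ∎

  -- The surplus exponent is written as a successor because the units at hand are the 1 - q^e with e
  -- ≥ 1.
  ^-split-< : ∀ x {b c} → b < c → x ^ c ≈ x ^ suc (c ∸ suc b) * x ^ b
  ^-split-< x {b} {c} b<c = trans
    (^-congʳ x (≡.sym (≡.trans (≡.sym (ℕ.+-suc (c ∸ suc b) b)) (ℕ.m∸n+n≡m b<c))))
    (^-homo-* x (suc (c ∸ suc b)) b)

  -- The coefficients of f(t)/(1 - ut): this series g satisfies g = f + utg.
  geometricStep : Carrier → (ℕ → Carrier) → ℕ → Carrier
  geometricStep u f zero    = f zero
  geometricStep u f (suc n) = f (suc n) + u * geometricStep u f n

  one : ℕ → Carrier
  one zero    = 1#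
  one (suc _) = 0#

  -- The complete homogeneous symmetric polynomials of us, through their
  -- generating function ∏ 1/(1 - u t).
  h : List Carrier → ℕ → Carrier
  h = foldr geometricStep one

  geometricStep-cong : ∀ {u v f g} → u ≈ v → (∀ n → f n ≈ g n) → ∀ n → geometricStep u f n ≈ geometricStep v g n
  geometricStep-cong u≈v f≈g zero    = f≈g zero
  geometricStep-cong u≈v f≈g (suc n) = +-cong (f≈g (suc n)) (*-cong u≈v (geometricStep-cong u≈v f≈g n))

  h-zero : ∀ us → h us 0 ≈ 1#
  h-zero []       = refl
  h-zero (u ∷ us) = h-zero us

  h-homogeneous : ∀ {a} {X : Set a} x (f g : X → Carrier) → (∀ y → g y ≈ x * f y) →
                  ∀ ys n → h (map g ys) n ≈ x ^ n * h (map f ys) n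
  h-homogeneous x f g g≈xf []       zero    = sym (*-identityˡ _)
  h-homogeneous x f g g≈xf []       (suc n) = sym (zeroʳ _)
  h-homogeneous x f g g≈xf (y ∷ ys) zero    = h-homogeneous x f g g≈xf ys zero
  h-homogeneous x f g g≈xf (y ∷ ys) (suc n) = begin
    h (map g ys) (suc n) + g y * h (map g (y ∷ ys)) n
      ≈⟨ +-cong (h-homogeneous x f g g≈xf ys (suc n)) (*-cong (g≈xf y) (h-homogeneous x f g g≈xf (y ∷ ys) n)) ⟩
    x * x ^ n * h (map f ys) (suc n) + x * f y * (x ^ n * h (map f (y ∷ ys)) n)
      ≈⟨ solve 5 (λ a b k d e → a :* b :* k :+ a :* d :* (b :* e) := a :* b :* (k :+ d :* e)) refl x _ _ _ _ ⟩
    x * x ^ n * (h (map f ys) (suc n) + f y * h (map f (y ∷ ys)) n) ∎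

-- Partial fractions without division.

module Lagrange {c ℓ k} (A : CommutativeRing c ℓ) {K : Set k} (_≟_ : DecidableEquality K)
  (u v : K → CommutativeRing.Carrier A) where
  open CommutativeRing A hiding (zero)
  open RingLemmas A

  -- With `v` inverse to `u` these are the factors 1 - u_l/u_k. The diagonal is set to 1, so that a
  -- product over the whole list is the product over l ≠ k.
  d : K → K → Carrier
  d k l = if does (k ≟ l) then 1# else 1# - u l * v k

  d-same : ∀ k → d k k ≈ 1#
  d-same k = reflexive (if-yes (k ≟ k) ≡.refl)

  d-distinct : ∀ {k l} → k ≢ l → d k l ≈ 1# - u l * v k
  d-distinct {k} {l} k≢l = reflexive (if-no (k ≟ l) k≢l)

  -- `separated` says that u_k - u_l is not a zero divisor. It replaces the invertibility of the
  -- factors 1 - u_l/u_k, which fails for Laurent polynomials.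
  module _ (uv≈1 : ∀ k → u k * v k ≈ 1#)
           (separated : ∀ {k l} → k ≢ l → ∀ x → u k * x ≈ u l * x → x ≈ 0#) where

    -- Splitting t_l = (1 - u_k/u_l) t_l + u_k s_l drops k from the first sum, because 1 - u_k/u_l
    -- vanishes at l = k. The weights G_l d_{l,k} of that sum are the ones suited to the list
    -- without k.
    ∑-peel : ∀ {k ks} → All (k ≢_) ks → ∀ (G s t : K → Carrier) → (∀ l → t l ≈ u l * s l) →
             ∑ (λ l → G l * t l) (k ∷ ks) ≈
             ∑ (λ l → G l * d l k * t l) ks + u k * ∑ (λ l → G l * s l) (k ∷ ks)
    ∑-peel {k} {ks} k∉ks G s t t≈us = begin
      G k * t k + ∑ (λ l → G l * t l) ks
        ≈⟨ +-cong (trans (*-congˡ (t≈us k)) (x∙yz≈y∙xz _ _ _)) (Sum.fold-cong ks pointwise) ⟩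
      u k * (G k * s k) + ∑ (λ l → G l * d l k * t l + u k * (G l * s l)) ks
        ≈⟨ +-congˡ (trans (Sum.fold-∙ _ _ ks) (+-congˡ (sym (∑-distribˡ (u k) _ ks)))) ⟩
      u k * (G k * s k) + (∑ (λ l → G l * d l k * t l) ks + u k * ∑ (λ l → G l * s l) ks)
        ≈⟨ solve 4 (λ a b e f → a :* b :+ (e :+ a :* f) := e :+ a :* (b :+ f)) refl _ _ _ _ ⟩
      ∑ (λ l → G l * d l k * t l) ks + u k * (G k * s k + ∑ (λ l → G l * s l) ks) ∎
      where
      pointwise : ∀ {l} → l ∈ ks → G l * t l ≈ G l * d l k * t l + u k * (G l * s l)
      pointwise {l} l∈ks = begin
        G l * t l
          ≈⟨ *-congˡ (1-x*y (u k * v l) (t l)) ⟨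
        G l * ((1# - u k * v l) * t l + u k * v l * t l)
          ≈⟨ *-congˡ (+-cong (*-congʳ (sym (d-distinct (λ l≡k → All.lookup k∉ks l∈ks (≡.sym l≡k)))))
                             (*-congˡ (t≈us l))) ⟩
        G l * (d l k * t l + u k * v l * (u l * s l))
          ≈⟨ solve 7 (λ g e f a b m n → g :* (e :* f :+ a :* b :* (m :* n)) := g :* e :* f :+ a :* (g :* (m :* b :* n)))
               refl _ _ _ _ _ _ _ ⟩
        G l * d l k * t l + u k * (G l * (u l * v l * s l))
          ≈⟨ +-congˡ (*-congˡ (*-congˡ (trans (*-congʳ (uv≈1 l)) (*-identityˡ _)))) ⟩
        G l * d l k * t l + u k * (G l * s l) ∎

    -- Removing k₀ or k₁ from the list evaluates S₀ = ∑ G both as L + u₀X and as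
    -- L + u₁X, where X = ∑ G/u; separation then forces X = 0.
    lagrange : ∀ {k ks} → Unique (k ∷ ks) → ∀ L (G : K → Carrier) →
               (∀ {l} → l ∈ k ∷ ks → G l * ∏ (d l) (k ∷ ks) ≈ L) →
               ∀ n → ∑ (λ l → G l * u l ^ n) (k ∷ ks) ≈ L * h (map u (k ∷ ks)) n
    lagrange {k} {[]} _ L G G∏d≈L n =
      trans (+-identityʳ _) (*-cong Gk≈L (sym (h-singleton n)))
      where
      Gk≈L : G k ≈ L
      Gk≈L = trans (sym (trans (*-congˡ (trans (*-identityʳ _) (d-same k))) (*-identityʳ _))) (G∏d≈L (here ≡.refl))
      h-singleton : ∀ n → geometricStep (u k) one n ≈ u k ^ n
      h-singleton zero    = refl
      h-singleton (suc n) = trans (+-identityˡ _) (*-congˡ (h-singleton n))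
    lagrange {k₀} {k₁ ∷ ks} ((k₀≢k₁ ∷ k₀∉ks) ∷ (k₁∉ks ∷ unique)) L G G∏d≈L = total
      where
      S : ℕ → Carrier
      S n = ∑ (λ l → G l * u l ^ n) (k₀ ∷ k₁ ∷ ks)

      X : Carrier
      X = ∑ (λ l → G l * v l) (k₀ ∷ k₁ ∷ ks)

      -- The factor d_{l,k₀} moves from the product into the weight, so the shorter list keeps the
      -- same L.
      drop₀ : ∀ n → ∑ (λ l → G l * d l k₀ * u l ^ n) (k₁ ∷ ks) ≈ L * h (map u (k₁ ∷ ks)) n
      drop₀ = lagrange (k₁∉ks ∷ unique) L (λ l → G l * d l k₀)
        (λ l∈ → trans (*-assoc _ _ _) (G∏d≈L (there l∈)))

      drop₁ : ∀ n → ∑ (λ l → G l * d l k₁ * u l ^ n) (k₀ ∷ ks) ≈ L * h (map u (k₀ ∷ ks)) n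
      drop₁ = lagrange (k₀∉ks ∷ unique) L (λ l → G l * d l k₁)
        (λ l∈ → trans (trans (*-assoc _ _ _) (*-congˡ (x∙yz≈y∙xz _ _ _))) (G∏d≈L (skip l∈)))
        where
        skip : ∀ {l} → l ∈ k₀ ∷ ks → l ∈ k₀ ∷ k₁ ∷ ks
        skip (here p)  = here p
        skip (there p) = there (there p)

      swap : ∀ (f : K → Carrier) → ∑ f (k₀ ∷ k₁ ∷ ks) ≈ ∑ f (k₁ ∷ k₀ ∷ ks)
      swap f = solve 3 (λ a b e → a :+ (b :+ e) := b :+ (a :+ e)) refl _ _ _

      S₀≈L+u₀X : S 0 ≈ L + u k₀ * X
      S₀≈L+u₀X = trans
        (∑-peel (k₀≢k₁ ∷ k₀∉ks) G v (λ l → u l ^ 0) (λ l → sym (uv≈1 l)))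
        (+-congʳ (trans (drop₀ 0) (trans (*-congˡ (h-zero (map u (k₁ ∷ ks)))) (*-identityʳ L))))

      S₀≈L+u₁X : S 0 ≈ L + u k₁ * X
      S₀≈L+u₁X = trans (swap _) (trans
        (∑-peel ((k₀≢k₁ ∘ ≡.sym) ∷ k₁∉ks) G v (λ l → u l ^ 0) (λ l → sym (uv≈1 l)))
        (+-cong (trans (drop₁ 0) (trans (*-congˡ (h-zero (map u (k₀ ∷ ks)))) (*-identityʳ L)))
                (*-congˡ (sym (swap _)))))

      X≈0 : X ≈ 0#
      X≈0 = separated k₀≢k₁ X (+-cancelˡ L _ _ (trans (sym S₀≈L+u₀X) S₀≈L+u₁X))

      total : ∀ n → S n ≈ L * h (map u (k₀ ∷ k₁ ∷ ks)) n
      total zero = begin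
        S 0             ≈⟨ S₀≈L+u₀X ⟩
        L + u k₀ * X    ≈⟨ +-congˡ (trans (*-congˡ X≈0) (zeroʳ _)) ⟩
        L + 0#          ≈⟨ +-identityʳ L ⟩
        L               ≈⟨ *-identityʳ L ⟨
        L * 1#          ≈⟨ *-congˡ (h-zero (map u (k₀ ∷ k₁ ∷ ks))) ⟨
        L * h (map u (k₀ ∷ k₁ ∷ ks)) 0 ∎
      -- Peeling off k₀ expresses S (n+1) through S n by the very recursion that defines `h`.
      total (suc n) = begin
        S (suc n)
          ≈⟨ ∑-peel (k₀≢k₁ ∷ k₀∉ks) G (λ l → u l ^ n) (λ l → u l ^ suc n) (λ l → refl) ⟩
        ∑ (λ l → G l * d l k₀ * u l ^ suc n) (k₁ ∷ ks) + u k₀ * S n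
          ≈⟨ +-cong (drop₀ (suc n)) (*-congˡ (total n)) ⟩
        L * h (map u (k₁ ∷ ks)) (suc n) + u k₀ * (L * h (map u (k₀ ∷ k₁ ∷ ks)) n)
          ≈⟨ solve 4 (λ l a b e → l :* a :+ b :* (l :* e) := l :* (a :+ b :* e)) refl _ _ _ _ ⟩
        L * h (map u (k₀ ∷ k₁ ∷ ks)) (suc n) ∎

-- q-shifted factorials.

module QCalculus {c ℓ} (A : CommutativeRing c ℓ) (q : CommutativeRing.Carrier A) where
  open CommutativeRing A hiding (zero)
  open RingLemmas A
  open QPochhammer rawRing

  ⟨⟩-cong : ∀ {y z} → y ≈ z → ∀ n → ⟨ y ︔ q ⟩ n ≈ ⟨ z ︔ q ⟩ n
  ⟨⟩-cong y≈z zero    = refl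
  ⟨⟩-cong y≈z (suc n) = *-cong (⟨⟩-cong y≈z n) (+-congˡ (-‿cong (*-congˡ y≈z)))

  ⟨⟩-+ : ∀ z m n → ⟨ z ︔ q ⟩ (n ℕ.+ m) ≈ ⟨ z ︔ q ⟩ m * ⟨ q ^ m * z ︔ q ⟩ n
  ⟨⟩-+ z m zero    = sym (*-identityʳ _)
  ⟨⟩-+ z m (suc n) = trans
    (*-cong (⟨⟩-+ z m n) (+-congˡ (-‿cong (trans (*-congʳ (^-homo-* q n m)) (*-assoc _ _ _)))))
    (*-assoc _ _ _)

  ⟨⟩-peel : ∀ z n → ⟨ z ︔ q ⟩ suc n ≈ (1# - z) * ⟨ q * z ︔ q ⟩ n
  ⟨⟩-peel z n = begin
    ⟨ z ︔ q ⟩ suc n                      ≡⟨ ≡.cong (⟨ z ︔ q ⟩_) (ℕ.+-comm 1 n) ⟩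
    ⟨ z ︔ q ⟩ (n ℕ.+ 1)                  ≈⟨ ⟨⟩-+ z 1 n ⟩
    ⟨ z ︔ q ⟩ 1 * ⟨ q ^ 1 * z ︔ q ⟩ n    ≈⟨ *-cong (trans (*-identityˡ _) (+-congˡ (-‿cong (*-identityˡ z))))
                                               (⟨⟩-cong (*-congʳ (*-identityʳ q)) n) ⟩
    (1# - z) * ⟨ q * z ︔ q ⟩ n ∎

  -- With Y = 1/X both sides are -Y (X;q)_{C+1}, with its last or its first factor split off.
  ⟨⟩-shift : ∀ {X Y} → X * Y ≈ 1# → ∀ C → (q ^ C - Y) * ⟨ X ︔ q ⟩ C ≈ (1# - Y) * ⟨ q * X ︔ q ⟩ C
  ⟨⟩-shift XY≈1 zero = refl
  ⟨⟩-shift {X} {Y} XY≈1 (suc C) = begin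
    (q * q ^ C - Y) * (⟨ X ︔ q ⟩ C * (1# - q ^ C * X))
      ≈⟨ solve 3 (λ a b k → a :* (b :* k) := b :* (a :* k)) refl _ _ _ ⟩
    ⟨ X ︔ q ⟩ C * ((q * q ^ C - Y) * (1# - q ^ C * X))
      ≈⟨ *-congˡ (trans (expand (q * q ^ C) (q ^ C)) (trans middle (sym (expand (q ^ C) (q ^ C * q))))) ⟩
    ⟨ X ︔ q ⟩ C * ((q ^ C - Y) * (1# - q ^ C * q * X))
      ≈⟨ solve 3 (λ a b k → b :* (a :* k) := a :* b :* k) refl _ _ _ ⟩
    (q ^ C - Y) * ⟨ X ︔ q ⟩ C * (1# - q ^ C * q * X)
      ≈⟨ *-cong (⟨⟩-shift XY≈1 C) (+-congˡ (-‿cong (*-assoc _ _ _))) ⟩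
    (1# - Y) * ⟨ q * X ︔ q ⟩ C * (1# - q ^ C * (q * X))
      ≈⟨ *-assoc _ _ _ ⟩
    (1# - Y) * (⟨ q * X ︔ q ⟩ C * (1# - q ^ C * (q * X))) ∎
    where
    expand : ∀ a b → (a - Y) * (1# - b * X) ≈ a + b + (- Y + - (a * b * X))
    expand a b = begin
      (a - Y) * (1# - b * X)
        ≈⟨ solve 3 (λ a y z → (a :+ y) :* (con 1 :+ z) := a :+ y :* z :+ (y :+ a :* z)) refl a (- Y) (- (b * X)) ⟩
      a + - Y * - (b * X) + (- Y + a * - (b * X))
        ≈⟨ +-cong (+-congˡ neg-neg) (+-congˡ (trans (sym (-‿distribʳ-* _ _)) (-‿cong (sym (*-assoc _ _ _))))) ⟩
      a + b + (- Y + - (a * b * X)) ∎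
      where
      neg-neg : - Y * - (b * X) ≈ b
      neg-neg = begin
        - Y * - (b * X)  ≈⟨ -x*-y≈x*y Y (b * X) ⟩
        Y * (b * X)      ≈⟨ solve 3 (λ y b x → y :* (b :* x) := b :* (x :* y)) refl _ _ _ ⟩
        b * (X * Y)      ≈⟨ *-congˡ XY≈1 ⟩
        b * 1#           ≈⟨ *-identityʳ b ⟩
        b                ∎
    middle : q * q ^ C + q ^ C + (- Y + - (q * q ^ C * q ^ C * X)) ≈
             q ^ C + q ^ C * q + (- Y + - (q ^ C * (q ^ C * q) * X))
    middle = +-cong (solve 2 (λ q p → q :* p :+ p := p :+ p :* q) refl q (q ^ C))
      (+-congˡ (-‿cong (solve 3 (λ q p x → q :* p :* p :* x := p :* (p :* q) :* x) refl q (q ^ C) X)))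

  -- This is (y;q)_t (q/y;q)_C divided by (q^(1-t)/y;q)_C. By `⟨⟩-shift`, each step from the base
  -- q^(1-i)/y down to q^(-i)/y trades a factor 1 - q^i y for q^C - q^i y.
  shifted : ℕ → Carrier → ℕ → Carrier
  shifted C y zero    = 1#
  shifted C y (suc t) = shifted C y t * (q ^ C - q ^ t * y)

  -- The quotient of (y;q)_B (q/y;q)_C by (q^{1-t}/y;q)_C, for t ≤ B.
  quotient : ℕ → ℕ → Carrier → ℕ → Carrier
  quotient B C y t = shifted C y t * ⟨ q ^ t * y ︔ q ⟩ (B ∸ t)

  module _ {r} (qr≈1 : q * r ≈ 1#) where

    shifted-⟨⟩ : ∀ {x y} → x * y ≈ 1# → ∀ C t →
                 shifted C y t * ⟨ r ^ t * (q * x) ︔ q ⟩ C ≈ ⟨ y ︔ q ⟩ t * ⟨ q * x ︔ q ⟩ C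
    shifted-⟨⟩ xy≈1 C zero = *-congˡ (⟨⟩-cong (*-identityˡ _) C)
    shifted-⟨⟩ {x} {y} xy≈1 C (suc t) = begin
      shifted C y t * (q ^ C - q ^ t * y) * ⟨ X ︔ q ⟩ C
        ≈⟨ *-assoc _ _ _ ⟩
      shifted C y t * ((q ^ C - q ^ t * y) * ⟨ X ︔ q ⟩ C)
        ≈⟨ *-congˡ (⟨⟩-shift XY≈1 C) ⟩
      shifted C y t * ((1# - q ^ t * y) * ⟨ q * X ︔ q ⟩ C)
        ≈⟨ solve 3 (λ a b k → a :* (b :* k) := b :* (a :* k)) refl _ _ _ ⟩
      (1# - q ^ t * y) * (shifted C y t * ⟨ q * X ︔ q ⟩ C)
        ≈⟨ *-congˡ (trans (*-congˡ (⟨⟩-cong qX≈ C)) (shifted-⟨⟩ xy≈1 C t)) ⟩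
      (1# - q ^ t * y) * (⟨ y ︔ q ⟩ t * ⟨ q * x ︔ q ⟩ C)
        ≈⟨ solve 3 (λ a b k → b :* (a :* k) := a :* b :* k) refl _ _ _ ⟩
      ⟨ y ︔ q ⟩ t * (1# - q ^ t * y) * ⟨ q * x ︔ q ⟩ C ∎
      where
      X : Carrier
      X = r ^ suc t * (q * x)
      qX≈ : q * X ≈ r ^ t * (q * x)
      qX≈ = begin
        q * (r * r ^ t * (q * x))  ≈⟨ solve 4 (λ q r s x → q :* (r :* s :* x) := q :* r :* (s :* x)) refl q r _ _ ⟩
        q * r * (r ^ t * (q * x))  ≈⟨ trans (*-congʳ qr≈1) (*-identityˡ _) ⟩
        r ^ t * (q * x)            ∎
      XY≈1 : X * (q ^ t * y) ≈ 1#
      XY≈1 = begin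
        r * r ^ t * (q * x) * (q ^ t * y)
          ≈⟨ solve 6 (λ r s q x p y → r :* s :* (q :* x) :* (p :* y) := q :* r :* (p :* s) :* (x :* y)) refl _ _ _ _ _ _ ⟩
        q * r * (q ^ t * r ^ t) * (x * y)
          ≈⟨ *-cong (*-cong qr≈1 (inverse-^ qr≈1 t)) xy≈1 ⟩
        1# * 1# * 1#
          ≈⟨ trans (*-identityʳ _) (*-identityʳ _) ⟩
        1# ∎

    quotient-spec : ∀ {x y} → x * y ≈ 1# → ∀ {B} C {t} → t ≤ B →
                    quotient B C y t * ⟨ r ^ t * (q * x) ︔ q ⟩ C ≈ ⟨ y ︔ q ⟩ B * ⟨ q * x ︔ q ⟩ C
    quotient-spec {x} {y} xy≈1 {B} C {t} t≤B = begin
      shifted C y t * ⟨ q ^ t * y ︔ q ⟩ (B ∸ t) * ⟨ r ^ t * (q * x) ︔ q ⟩ C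
        ≈⟨ xy∙z≈xz∙y _ _ _ ⟩
      shifted C y t * ⟨ r ^ t * (q * x) ︔ q ⟩ C * ⟨ q ^ t * y ︔ q ⟩ (B ∸ t)
        ≈⟨ *-congʳ (shifted-⟨⟩ xy≈1 C t) ⟩
      ⟨ y ︔ q ⟩ t * ⟨ q * x ︔ q ⟩ C * ⟨ q ^ t * y ︔ q ⟩ (B ∸ t)
        ≈⟨ xy∙z≈xz∙y _ _ _ ⟩
      ⟨ y ︔ q ⟩ t * ⟨ q ^ t * y ︔ q ⟩ (B ∸ t) * ⟨ q * x ︔ q ⟩ C
        ≈⟨ *-congʳ (⟨⟩-+ y t (B ∸ t)) ⟨
      ⟨ y ︔ q ⟩ (B ∸ t ℕ.+ t) * ⟨ q * x ︔ q ⟩ C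
        ≡⟨ ≡.cong (λ n → ⟨ y ︔ q ⟩ n * ⟨ q * x ︔ q ⟩ C) (ℕ.m∸n+n≡m t≤B) ⟩
      ⟨ y ︔ q ⟩ B * ⟨ q * x ︔ q ⟩ C ∎

  -- h_M(1, q, ..., q^B) is the Gaussian binomial coefficient of M + B over B. Separating the node 1
  -- from the others, which are q times the nodes for B - 1, gives its q-Pascal rule.
  h-powers : ∀ B M → ⟨ q ︔ q ⟩ B * h (map (q ^_) (upTo (suc B))) M ≈ ⟨ q ^ suc M ︔ q ⟩ B
  h-powers B zero = trans
    (*-congˡ (h-zero (map (q ^_) (upTo (suc B)))))
    (trans (*-identityʳ _) (⟨⟩-cong (sym (*-identityʳ q)) B))
  h-powers B (suc M) = begin
    ⟨ q ︔ q ⟩ B * (h (map (q ^_) (applyUpTo suc B)) (suc M) + 1# * h (map (q ^_) (upTo (suc B))) M)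
      ≈⟨ *-congˡ (+-cong tail (*-identityˡ _)) ⟩
    ⟨ q ︔ q ⟩ B * (q ^ suc M * h (map (q ^_) (upTo B)) (suc M) + h (map (q ^_) (upTo (suc B))) M)
      ≈⟨ distribˡ _ _ _ ⟩
    ⟨ q ︔ q ⟩ B * (q ^ suc M * h (map (q ^_) (upTo B)) (suc M)) + ⟨ q ︔ q ⟩ B * h (map (q ^_) (upTo (suc B))) M
      ≈⟨ +-congˡ (h-powers B M) ⟩
    ⟨ q ︔ q ⟩ B * (q ^ suc M * h (map (q ^_) (upTo B)) (suc M)) + ⟨ q ^ suc M ︔ q ⟩ B
      ≈⟨ combine B ⟩
    ⟨ q ^ suc (suc M) ︔ q ⟩ B ∎
    where
    tail : h (map (q ^_) (applyUpTo suc B)) (suc M) ≈ q ^ suc M * h (map (q ^_) (upTo B)) (suc M)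
    tail = trans
      (reflexive (≡.cong (λ bs → h bs (suc M))
        (≡.trans (≡.cong (map (q ^_)) (≡.sym (List.map-upTo suc B))) (≡.sym (List.map-∘ (upTo B))))))
      (h-homogeneous q (q ^_) (λ b → q ^ suc b) (λ _ → refl) (upTo B) (suc M))

    combine : ∀ B → ⟨ q ︔ q ⟩ B * (q ^ suc M * h (map (q ^_) (upTo B)) (suc M)) + ⟨ q ^ suc M ︔ q ⟩ B ≈
                    ⟨ q ^ suc (suc M) ︔ q ⟩ B
    combine zero = trans (+-congʳ (trans (*-identityˡ _) (zeroʳ _))) (+-identityˡ _)
    combine (suc B) = begin
      ⟨ q ︔ q ⟩ B * (1# - q ^ B * q) * (q ^ suc M * h (map (q ^_) (upTo (suc B))) (suc M)) + ⟨ q ^ suc M ︔ q ⟩ suc B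
        ≈⟨ +-cong (solve 4 (λ a b k m → a :* b :* (k :* m) := a :* m :* (b :* k)) refl _ _ _ _)
                  (⟨⟩-peel (q ^ suc M) B) ⟩
      ⟨ q ︔ q ⟩ B * h (map (q ^_) (upTo (suc B))) (suc M) * ((1# - q ^ B * q) * q ^ suc M)
        + (1# - q ^ suc M) * ⟨ q ^ suc (suc M) ︔ q ⟩ B
        ≈⟨ +-congʳ (*-congʳ (h-powers B (suc M))) ⟩
      ⟨ q ^ suc (suc M) ︔ q ⟩ B * ((1# - q ^ B * q) * q ^ suc M) + (1# - q ^ suc M) * ⟨ q ^ suc (suc M) ︔ q ⟩ B
        ≈⟨ solve 3 (λ p a b → p :* a :+ b :* p := p :* (a :+ b)) refl _ _ _ ⟩
      ⟨ q ^ suc (suc M) ︔ q ⟩ B * ((1# - q ^ B * q) * q ^ suc M + (1# - q ^ suc M))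
        ≈⟨ *-congˡ telescope ⟩
      ⟨ q ^ suc (suc M) ︔ q ⟩ B * (1# - q ^ B * q ^ suc (suc M)) ∎
      where
      telescope : (1# - q ^ B * q) * q ^ suc M + (1# - q ^ suc M) ≈ 1# - q ^ B * q ^ suc (suc M)
      telescope = begin
        (1# - q ^ B * q) * q ^ suc M + (1# - q ^ suc M)
          ≈⟨ solve 3 (λ a p n → (con 1 :+ a) :* p :+ (con 1 :+ n) := con 1 :+ a :* p :+ (p :+ n)) refl _ _ _ ⟩
        1# + - (q ^ B * q) * q ^ suc M + (q ^ suc M - q ^ suc M)
          ≈⟨ trans (+-congˡ (-‿inverseʳ _)) (+-identityʳ _) ⟩
        1# + - (q ^ B * q) * q ^ suc M
          ≈⟨ +-congˡ (trans (sym (-‿distribˡ-* _ _)) (-‿cong (*-assoc _ _ _))) ⟩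
        1# - q ^ B * q ^ suc (suc M) ∎

-- Generic q: units, and partial fractions for powers of q.

record IsGeneric {c ℓ} (A : CommutativeRing c ℓ) (q : CommutativeRing.Carrier A) : Set (c ⊔ ℓ) where
  open CommutativeRing A
  open RingLemmas A using (_^_)
  field
    r    : Carrier
    qr≈1 : q * r ≈ 1#
    1-q^ : ∀ e → Σ Carrier λ y → (1# - q ^ suc e) * y ≈ 1#

module QUnits {c ℓ} (A : CommutativeRing c ℓ) {q : CommutativeRing.Carrier A} (generic : IsGeneric A q) where
  open CommutativeRing A hiding (zero)
  open RingLemmas A
  open QPochhammer rawRing
  open QCalculus A q
  open IsGeneric generic
  open Lagrange A ℕ._≟_ (q ^_) (r ^_)

  ^-separated-< : ∀ {b c} → b < c → ∀ x → q ^ b * x ≈ q ^ c * x → x ≈ 0#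
  ^-separated-< {b} {c} b<c x eq = unit-cancel (proj₂ (1-q^ (c ∸ suc b))) (unit-cancel (inverse-^ qr≈1 b) (begin
    q ^ b * ((1# - q ^ e) * x)
      ≈⟨ solve 3 (λ p m x → p :* ((con 1 :+ m) :* x) := p :* x :+ m :* (p :* x)) refl _ _ _ ⟩
    q ^ b * x + - q ^ e * (q ^ b * x)
      ≈⟨ +-cong (trans eq (trans (*-congʳ (^-split-< q b<c)) (*-assoc _ _ _))) (sym (-‿distribˡ-* _ _)) ⟩
    q ^ e * (q ^ b * x) - q ^ e * (q ^ b * x)
      ≈⟨ -‿inverseʳ _ ⟩
    0# ∎))
    where
    e : ℕ
    e = suc (c ∸ suc b)

  ^-separated : ∀ {b c} → b ≢ c → ∀ x → q ^ b * x ≈ q ^ c * x → x ≈ 0#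
  ^-separated {b} {c} b≢c x eq with ℕ.<-cmp b c
  ... | tri< b<c _ _ = ^-separated-< b<c x eq
  ... | tri≈ _ b≡c _ = ⊥-elim (b≢c b≡c)
  ... | tri> _ _ c<b = ^-separated-< c<b x (sym eq)

  d-unit : ∀ b c → Σ Carrier λ y → d b c * y ≈ 1#
  d-unit b c with ℕ.<-cmp b c
  ... | tri≈ _ ≡.refl _ = 1# , trans (*-identityʳ _) (d-same b)
  ... | tri< b<c b≢c _ = proj₁ (1-q^ e) , trans (*-congʳ (trans (d-distinct b≢c) (+-congˡ (-‿cong q^c*r^b)))) (proj₂ (1-q^ e))
    where
    e : ℕ
    e = c ∸ suc b
    q^c*r^b : q ^ c * r ^ b ≈ q ^ suc e
    q^c*r^b = begin
      q ^ c * r ^ b                ≈⟨ *-congʳ (^-split-< q b<c) ⟩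
      q ^ suc e * q ^ b * r ^ b    ≈⟨ *-assoc _ _ _ ⟩
      q ^ suc e * (q ^ b * r ^ b)  ≈⟨ *-congˡ (inverse-^ qr≈1 b) ⟩
      q ^ suc e * 1#               ≈⟨ *-identityʳ _ ⟩
      q ^ suc e                    ∎
  -- Here 1 - q^(c-b) equals -q^(c-b) (1 - q^(b-c)), so the inverse of 1 - q^(b-c) is multiplied by
  -- -q^(b-c).
  ... | tri> _ b≢c c<b = - q ^ suc e * proj₁ (1-q^ e) , (begin
    d b c * (- q ^ suc e * proj₁ (1-q^ e))
      ≈⟨ *-assoc _ _ _ ⟨
    d b c * - q ^ suc e * proj₁ (1-q^ e)
      ≈⟨ *-congʳ (trans (*-congʳ (trans (d-distinct b≢c) (+-congˡ (-‿cong q^c*r^b)))) flip) ⟩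
    (1# - q ^ suc e) * proj₁ (1-q^ e)
      ≈⟨ proj₂ (1-q^ e) ⟩
    1# ∎)
    where
    e : ℕ
    e = b ∸ suc c
    q^c*r^b : q ^ c * r ^ b ≈ r ^ suc e
    q^c*r^b = begin
      q ^ c * r ^ b                ≈⟨ *-congˡ (^-split-< r c<b) ⟩
      q ^ c * (r ^ suc e * r ^ c)  ≈⟨ x∙yz≈y∙xz _ _ _ ⟩
      r ^ suc e * (q ^ c * r ^ c)  ≈⟨ *-congˡ (inverse-^ qr≈1 c) ⟩
      r ^ suc e * 1#               ≈⟨ *-identityʳ _ ⟩
      r ^ suc e                    ∎
    flip : (1# - r ^ suc e) * - q ^ suc e ≈ 1# - q ^ suc e
    flip = begin
      (1# - r ^ suc e) * - q ^ suc e
        ≈⟨ solve 2 (λ m n → (con 1 :+ m) :* n := m :* n :+ n) refl _ _ ⟩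
      - r ^ suc e * - q ^ suc e - q ^ suc e
        ≈⟨ +-congʳ (trans (-x*-y≈x*y _ _) (trans (*-comm _ _) (inverse-^ qr≈1 (suc e)))) ⟩
      1# - q ^ suc e ∎

  -- The inverse of ∏ (1 - q^{c-b}) over c < B, c ≠ b.
  κ⁻¹ : ℕ → ℕ → Carrier
  κ⁻¹ B b = ∏ (λ c → proj₁ (d-unit b c)) (upTo B)

  κ⁻¹-inverse : ∀ B b → κ⁻¹ B b * ∏ (d b) (upTo B) ≈ 1#
  κ⁻¹-inverse B b = begin
    κ⁻¹ B b * ∏ (d b) (upTo B)                       ≈⟨ *-comm _ _ ⟩
    ∏ (d b) (upTo B) * κ⁻¹ B b                       ≈⟨ Prod.fold-∙ _ _ (upTo B) ⟨
    ∏ (λ c → d b c * proj₁ (d-unit b c)) (upTo B)    ≈⟨ Prod.fold-cong (upTo B) (λ {c} _ → proj₂ (d-unit b c)) ⟩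
    ∏ (λ _ → 1#) (upTo B)                            ≈⟨ Prod.fold-ε (upTo B) ⟩
    1#                                               ∎

  -- By partial fractions at the nodes 1, q, ..., q^B, with L = 1 and weights `κ⁻¹`, the sum is h_M
  -- at these nodes, a Gaussian binomial coefficient.
  ∑κ⁻¹ : ∀ B M → ⟨ q ︔ q ⟩ B * ∑ (λ b → κ⁻¹ (suc B) b * (q ^ b) ^ M) (upTo (suc B)) ≈ ⟨ q ^ suc M ︔ q ⟩ B
  ∑κ⁻¹ B M = begin
    ⟨ q ︔ q ⟩ B * ∑ (λ b → κ⁻¹ (suc B) b * (q ^ b) ^ M) (upTo (suc B))
      ≈⟨ *-congˡ (lagrange (inverse-^ qr≈1) ^-separated (Unique.upTo⁺ (suc B)) 1# (κ⁻¹ (suc B))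
                           (λ {b} _ → κ⁻¹-inverse (suc B) b) M) ⟩
    ⟨ q ︔ q ⟩ B * (1# * h (map (q ^_) (upTo (suc B))) M)
      ≈⟨ *-congˡ (*-identityˡ _) ⟩
    ⟨ q ︔ q ⟩ B * h (map (q ^_) (upTo (suc B))) M
      ≈⟨ h-powers B M ⟩
    ⟨ q ^ suc M ︔ q ⟩ B ∎

-- Exponent vectors and the ring of Laurent polynomials.

infixl 6 _⊕_ _⊖_
_⊕_ _⊖_ : ∀ {s} → Vec ℤ s → Vec ℤ s → Vec ℤ s
_⊕_ = zipWith ℤ._+_
_⊖_ = zipWith ℤ._-_

𝟘 : ∀ {s} → Vec ℤ s
𝟘 = replicate _ (+ 0)

⊕-⊖ : ∀ {s} (e k : Vec ℤ s) → e ⊕ (k ⊖ e) ≡ k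
⊕-⊖ []      []      = ≡.refl
⊕-⊖ (x ∷ e) (y ∷ k) = ≡.cong₂ _∷_ (≡.trans (ℤ.+-comm x _) (≡.trans (ℤ.+-assoc y (ℤ.- x) x)
  (≡.trans (≡.cong (ℤ._+_ y) (ℤ.+-inverseˡ x)) (ℤ.+-identityʳ y)))) (⊕-⊖ e k)

⊕-⊖-cancel : ∀ {s} (e f : Vec ℤ s) → (e ⊕ f) ⊖ e ≡ f
⊕-⊖-cancel []      []      = ≡.refl
⊕-⊖-cancel (x ∷ e) (y ∷ f) = ≡.cong₂ _∷_ (≡.trans (≡.cong (ℤ._- x) (ℤ.+-comm x y)) (≡.trans (ℤ.+-assoc y x (ℤ.- x))
  (≡.trans (≡.cong (ℤ._+_ y) (ℤ.+-inverseʳ x)) (ℤ.+-identityʳ y)))) (⊕-⊖-cancel e f)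

⊖-⊕ : ∀ {s} (k e f : Vec ℤ s) → k ⊖ (e ⊕ f) ≡ (k ⊖ e) ⊖ f
⊖-⊕ []      []      []      = ≡.refl
⊖-⊕ (z ∷ k) (x ∷ e) (y ∷ f) = ≡.cong₂ _∷_
  (≡.trans (≡.cong (ℤ._+_ z) (ℤ.neg-distrib-+ x y)) (≡.sym (ℤ.+-assoc z (ℤ.- x) (ℤ.- y)))) (⊖-⊕ k e f)

⊖-identityʳ : ∀ {s} (k : Vec ℤ s) → k ⊖ 𝟘 ≡ k
⊖-identityʳ []      = ≡.refl
⊖-identityʳ (x ∷ k) = ≡.cong₂ _∷_ (ℤ.+-identityʳ x) (⊖-identityʳ k)

⊕-comm : ∀ {s} (e f : Vec ℤ s) → e ⊕ f ≡ f ⊕ e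
⊕-comm = Vec.zipWith-comm ℤ.+-comm

⊕-power : ∀ {s} (a : Fin s) x y → (𝟘 [ a ]≔ x) ⊕ (𝟘 [ a ]≔ y) ≡ 𝟘 [ a ]≔ (x ℤ.+ y)
⊕-power {suc s} zero    x y = ≡.cong (_ ∷_) (Vec.zipWith-identityˡ ℤ.+-identityˡ 𝟘)
⊕-power {suc s} (suc a) x y = ≡.cong (_ ∷_) (⊕-power a x y)

power-zero : ∀ {s} (a : Fin s) → 𝟘 [ a ]≔ (+ 0) ≡ 𝟘
power-zero zero    = ≡.refl
power-zero (suc a) = ≡.cong (_ ∷_) (power-zero a)

lookup-power-same : ∀ {s} (a : Fin s) x → lookup (𝟘 [ a ]≔ x) a ≡ x
lookup-power-same a x = Vec.lookup∘updateAt a 𝟘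

lookup-power-other : ∀ {s} {a i : Fin s} → i ≢ a → ∀ x → lookup (𝟘 [ a ]≔ x) i ≡ + 0
lookup-power-other {a = a} {i} i≢a x = ≡.trans (Vec.lookup∘updateAt′ i a i≢a 𝟘) (Vec.lookup-replicate i (+ 0))

module LaurentRing {c ℓ} (R : CommutativeRing c ℓ) (s : ℕ) where
  open CommutativeRing R hiding (zero)
  open RingLemmas R
  open Laurent R s
  private module L = RawRing laurent

  term : Term → Exponent → Carrier
  term (r , e) k = if does (Vec.≡-dec ℤ._≟_ e k) then r else 0#

  term-· : ∀ t t′ k → term (t · t′) k ≈ proj₁ t * term t′ (k ⊖ proj₂ t)
  term-· (r , e) (r′ , e′) k with
    does (Vec.≡-dec ℤ._≟_ (e ⊕ e′) k) | does (Vec.≡-dec ℤ._≟_ e′ (k ⊖ e)) |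
    does-⇔ (mk⇔ (λ eq → ≡.trans (≡.sym (⊕-⊖-cancel e e′)) (≡.cong (_⊖ e) eq))
                 (λ eq → ≡.trans (≡.cong (e ⊕_) eq) (⊕-⊖ e k)))
            (Vec.≡-dec ℤ._≟_ (e ⊕ e′) k) (Vec.≡-dec ℤ._≟_ e′ (k ⊖ e))
  ... | true  | _ | ≡.refl = refl
  ... | false | _ | ≡.refl = sym (zeroʳ r)

  coefficient-++ : ∀ p p′ k → coefficient (p ++ p′) k ≈ coefficient p k + coefficient p′ k
  coefficient-++ []      p′ k = sym (+-identityˡ _)
  coefficient-++ (t ∷ p) p′ k = trans (+-congˡ (coefficient-++ p p′ k)) (sym (+-assoc _ _ _))

  coefficient-map : ∀ t p k → coefficient (map (t ·_) p) k ≈ proj₁ t * coefficient p (k ⊖ proj₂ t)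
  coefficient-map t []       k = sym (zeroʳ _)
  coefficient-map t (t′ ∷ p) k =
    trans (+-cong (term-· t t′ k) (coefficient-map t p k)) (sym (distribˡ _ _ _))

  coefficient-neg : ∀ p k → coefficient (L.- p) k ≈ - coefficient p k
  coefficient-neg []            k = sym -0#≈0#
  coefficient-neg ((r , e) ∷ p) k = trans (+-cong neg-term (coefficient-neg p k)) (-‿+-comm _ _)
    where
    neg-term : term (- r , e) k ≈ - term (r , e) k
    neg-term with does (Vec.≡-dec ℤ._≟_ e k)
    ... | true  = refl
    ... | false = sym -0#≈0#

  coefficient-cons-* : ∀ t p p′ k →
    coefficient ((t ∷ p) L.* p′) k ≈ proj₁ t * coefficient p′ (k ⊖ proj₂ t) + coefficient (p L.* p′) k
  coefficient-cons-* t p p′ k =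
    trans (coefficient-++ (map (t ·_) p′) (p L.* p′) k) (+-congʳ (coefficient-map t p′ k))

  -- Traversing the left list expresses the coefficients of a product by those of its right factor,
  -- so only that factor can be replaced directly. Replacement on the left follows by commutativity.
  L-*-congˡ : ∀ p {p₁ p₂} → p₁ L.≈ p₂ → p L.* p₁ L.≈ p L.* p₂
  L-*-congˡ []      eq k = refl
  L-*-congˡ (t ∷ p) {p₁} {p₂} eq k = begin
    coefficient ((t ∷ p) L.* p₁) k
      ≈⟨ coefficient-cons-* t p p₁ k ⟩
    proj₁ t * coefficient p₁ (k ⊖ proj₂ t) + coefficient (p L.* p₁) k
      ≈⟨ +-cong (*-congˡ (eq _)) (L-*-congˡ p eq k) ⟩
    proj₁ t * coefficient p₂ (k ⊖ proj₂ t) + coefficient (p L.* p₂) k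
      ≈⟨ coefficient-cons-* t p p₂ k ⟨
    coefficient ((t ∷ p) L.* p₂) k ∎

  L-*-nilʳ : ∀ p → p L.* [] ≡ []
  L-*-nilʳ []      = ≡.refl
  L-*-nilʳ (t ∷ p) = L-*-nilʳ p

  -- The expansion along the right factor mirrors the one along the left factor that the definition
  -- of the product gives. Together they yield commutativity.
  L-*-consʳ : ∀ t p p′ k →
    coefficient (p L.* (t ∷ p′)) k ≈ proj₁ t * coefficient p (k ⊖ proj₂ t) + coefficient (p L.* p′) k
  L-*-consʳ t [] p′ k = sym (trans (+-identityʳ _) (zeroʳ _))
  L-*-consʳ t@(r , e) (t₁@(r₁ , e₁) ∷ p) p′ k = begin
    coefficient ((t₁ ∷ p) L.* (t ∷ p′)) k
      ≈⟨ coefficient-++ (map (t₁ ·_) (t ∷ p′)) (p L.* (t ∷ p′)) k ⟩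
    term (t₁ · t) k + coefficient (map (t₁ ·_) p′) k + coefficient (p L.* (t ∷ p′)) k
      ≈⟨ +-cong (+-congʳ (trans swap (term-· t t₁ k))) (L-*-consʳ t p p′ k) ⟩
    r * term t₁ (k ⊖ e) + coefficient (map (t₁ ·_) p′) k + (r * coefficient p (k ⊖ e) + coefficient (p L.* p′) k)
      ≈⟨ solve 5 (λ a b m n y → a :* b :+ m :+ (a :* n :+ y) := a :* (b :+ n) :+ (m :+ y)) refl _ _ _ _ _ ⟩
    r * (term t₁ (k ⊖ e) + coefficient p (k ⊖ e)) + (coefficient (map (t₁ ·_) p′) k + coefficient (p L.* p′) k)
      ≈⟨ +-congˡ (coefficient-++ (map (t₁ ·_) p′) (p L.* p′) k) ⟨
    r * (term t₁ (k ⊖ e) + coefficient p (k ⊖ e)) + coefficient ((t₁ ∷ p) L.* p′) k ∎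
    where
    swap : term (t₁ · t) k ≈ term (t · t₁) k
    swap rewrite ⊕-comm e₁ e with does (Vec.≡-dec ℤ._≟_ (e ⊕ e₁) k)
    ... | true  = *-comm r₁ r
    ... | false = refl

  L-*-comm : ∀ p p′ → p L.* p′ L.≈ p′ L.* p
  L-*-comm []      p′ k = reflexive (≡.cong (λ l → coefficient l k) (≡.sym (L-*-nilʳ p′)))
  L-*-comm (t ∷ p) p′ k = begin
    coefficient ((t ∷ p) L.* p′) k
      ≈⟨ coefficient-cons-* t p p′ k ⟩
    proj₁ t * coefficient p′ (k ⊖ proj₂ t) + coefficient (p L.* p′) k
      ≈⟨ +-congˡ (L-*-comm p p′ k) ⟩
    proj₁ t * coefficient p′ (k ⊖ proj₂ t) + coefficient (p′ L.* p) k
      ≈⟨ L-*-consʳ t p′ p k ⟨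
    coefficient (p′ L.* (t ∷ p)) k ∎

  L-*-distribʳ : ∀ p p₁ p₂ → (p₁ ++ p₂) L.* p L.≈ p₁ L.* p ++ p₂ L.* p
  L-*-distribʳ p p₁ p₂ k = reflexive (≡.cong (λ l → coefficient l k) (List.cartesianProductWith-distribʳ-++ _·_ p₁ p₂ p))

  map-* : ∀ t p p′ → map (t ·_) p L.* p′ L.≈ map (t ·_) (p L.* p′)
  map-* t []       p′ k = refl
  map-* t@(r , e) (t₁@(r₁ , e₁) ∷ p) p′ k = begin
    coefficient (map (t ·_) (t₁ ∷ p) L.* p′) k
      ≈⟨ coefficient-cons-* (t · t₁) (map (t ·_) p) p′ k ⟩
    r * r₁ * coefficient p′ (k ⊖ (e ⊕ e₁)) + coefficient (map (t ·_) p L.* p′) k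
      ≈⟨ +-cong (trans (*-assoc _ _ _) (reflexive (≡.cong (λ l → r * (r₁ * coefficient p′ l)) (⊖-⊕ k e e₁))))
                (trans (map-* t p p′ k) (coefficient-map t (p L.* p′) k)) ⟩
    r * (r₁ * coefficient p′ (k ⊖ e ⊖ e₁)) + r * coefficient (p L.* p′) (k ⊖ e)
      ≈⟨ distribˡ _ _ _ ⟨
    r * (r₁ * coefficient p′ (k ⊖ e ⊖ e₁) + coefficient (p L.* p′) (k ⊖ e))
      ≈⟨ *-congˡ (coefficient-cons-* t₁ p p′ (k ⊖ e)) ⟨
    r * coefficient ((t₁ ∷ p) L.* p′) (k ⊖ e)
      ≈⟨ coefficient-map t ((t₁ ∷ p) L.* p′) k ⟨
    coefficient (map (t ·_) ((t₁ ∷ p) L.* p′)) k ∎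

  L-*-assoc : ∀ p p₁ p₂ → (p L.* p₁) L.* p₂ L.≈ p L.* (p₁ L.* p₂)
  L-*-assoc []      p₁ p₂ k = refl
  L-*-assoc (t ∷ p) p₁ p₂ k = begin
    coefficient ((map (t ·_) p₁ ++ p L.* p₁) L.* p₂) k
      ≈⟨ L-*-distribʳ p₂ (map (t ·_) p₁) (p L.* p₁) k ⟩
    coefficient (map (t ·_) p₁ L.* p₂ ++ (p L.* p₁) L.* p₂) k
      ≈⟨ coefficient-++ (map (t ·_) p₁ L.* p₂) _ k ⟩
    coefficient (map (t ·_) p₁ L.* p₂) k + coefficient ((p L.* p₁) L.* p₂) k
      ≈⟨ +-cong (map-* t p₁ p₂ k) (L-*-assoc p p₁ p₂ k) ⟩
    coefficient (map (t ·_) (p₁ L.* p₂)) k + coefficient (p L.* (p₁ L.* p₂)) k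
      ≈⟨ coefficient-++ (map (t ·_) (p₁ L.* p₂)) _ k ⟨
    coefficient ((t ∷ p) L.* (p₁ L.* p₂)) k ∎

  coefficient-monomial-* : ∀ r e p k → coefficient (((r , e) ∷ []) L.* p) k ≈ r * coefficient p (k ⊖ e)
  coefficient-monomial-* r e p k = trans (coefficient-cons-* (r , e) [] p k) (+-identityʳ _)

  coefficient-constant-* : ∀ r p k → coefficient (constant r L.* p) k ≈ r * coefficient p k
  coefficient-constant-* r p k = trans (coefficient-monomial-* r 𝟘 p k)
    (reflexive (≡.cong (λ l → r * coefficient p l) (⊖-identityʳ k)))

  laurentRing : CommutativeRing c ℓ
  laurentRing = record
    { Carrier = L.Carrier
    ; _≈_ = L._≈_
    ; _+_ = L._+_
    ; _*_ = L._*_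
    ; -_  = L.-_
    ; 0#  = L.0#
    ; 1#  = L.1#
    ; isCommutativeRing = record
      { isRing = record
        { +-isAbelianGroup = record
          { isGroup = record
            { isMonoid = record
              { isSemigroup = record
                { isMagma = record
                  { isEquivalence = record
                    { refl  = λ k → refl
                    ; sym   = λ eq k → sym (eq k)
                    ; trans = λ eq₁ eq₂ k → trans (eq₁ k) (eq₂ k)
                    }
                  ; ∙-cong = λ {p} {p₁} {p₂} {p₃} eq₁ eq₂ k → trans (coefficient-++ p p₂ k)
                      (trans (+-cong (eq₁ k) (eq₂ k)) (sym (coefficient-++ p₁ p₃ k)))
                  }
                ; assoc = λ p p₁ p₂ k → reflexive (≡.cong (λ l → coefficient l k) (List.++-assoc p p₁ p₂))
                }
              ; identity = (λ p k → refl) , (λ p k → reflexive (≡.cong (λ l → coefficient l k) (List.++-identityʳ p)))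
              }
            ; inverse = (λ p k → trans (coefficient-++ (L.- p) p k)
                                  (trans (+-congʳ (coefficient-neg p k)) (-‿inverseˡ _)))
                      , (λ p k → trans (coefficient-++ p (L.- p) k)
                                  (trans (+-congˡ (coefficient-neg p k)) (-‿inverseʳ _)))
            ; ⁻¹-cong = λ {p} {p₁} eq k → trans (coefficient-neg p k)
                (trans (-‿cong (eq k)) (sym (coefficient-neg p₁ k)))
            }
          ; comm = λ p p₁ k → trans (coefficient-++ p p₁ k)
              (trans (+-comm _ _) (sym (coefficient-++ p₁ p k)))
          }
        ; *-cong = λ {p} {p₁} {p₂} {p₃} eq₁ eq₂ k → trans (L-*-congˡ p eq₂ k)
            (trans (L-*-comm p p₃ k) (trans (L-*-congˡ p₃ eq₁ k) (L-*-comm p₃ p₁ k)))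
        ; *-assoc = L-*-assoc
        ; *-identity = 1*p≈p , (λ p k → trans (L-*-comm p L.1# k) (1*p≈p p k))
        ; distrib = (λ p p₁ p₂ k → trans (L-*-comm p (p₁ ++ p₂) k) (trans (L-*-distribʳ p p₁ p₂ k)
              (trans (coefficient-++ (p₁ L.* p) (p₂ L.* p) k)
              (trans (+-cong (L-*-comm p₁ p k) (L-*-comm p₂ p k)) (sym (coefficient-++ (p L.* p₁) (p L.* p₂) k))))))
            , L-*-distribʳ
        }
      ; *-comm = L-*-comm
      }
    }
    where
    1*p≈p : ∀ p → L.1# L.* p L.≈ p
    1*p≈p p k = trans (coefficient-constant-* 1# p k) (*-identityˡ _)

-- Axioms for Laurent polynomials, and their model.

i≤∣i∣ : ∀ i → i ℤ.≤ + ℤ.∣ i ∣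
i≤∣i∣ (+ n)    = ℤ.≤-refl
i≤∣i∣ -[1+ n ] = ℤ.-≤+

-- Order a m p says that z_a^m divides p among the polynomials in z_a over the
-- other variables.
record LaurentAlgebra {c ℓ} (R : CommutativeRing c ℓ) (s : ℕ) : Set (lsuc (c ⊔ ℓ)) where
  open CommutativeRing R
  field
    polynomials : CommutativeRing c ℓ
  module L = CommutativeRing polynomials
  field
    coefficient            : L.Carrier → Vec ℤ s → Carrier
    coefficient-cong       : ∀ {p p′} → p L.≈ p′ → ∀ k → coefficient p k ≈ coefficient p′ k
    coefficient-+          : ∀ p p′ k → coefficient (p L.+ p′) k ≈ coefficient p k + coefficient p′ k
    coefficient-0          : ∀ k → coefficient L.0# k ≈ 0#
    coefficient-1          : coefficient L.1# 𝟘 ≈ 1#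
    extensional            : ∀ {p p′} → (∀ k → coefficient p k ≈ coefficient p′ k) → p L.≈ p′
    bounded                : ∀ i p → ∃[ N ] (∀ k → N ℤ.≤ lookup k i → coefficient p k ≈ 0#)
    constant               : Carrier → L.Carrier
    constant-1             : constant 1# L.≈ L.1#
    constant-neg           : ∀ r → constant (- r) L.≈ L.- constant r
    coefficient-constant   : ∀ r k → coefficient (constant r) k ≈ r * coefficient L.1# k
    coefficient-constant-* : ∀ r p k → coefficient (constant r L.* p) k ≈ r * coefficient p k
    var var⁻¹              : Fin s → L.Carrier
    var-inverse            : ∀ i → var i L.* var⁻¹ i L.≈ L.1#
    coefficient-var-*      : ∀ i p k → coefficient (var i L.* p) k ≈ coefficient p (k ⊖ (𝟘 [ i ]≔ + 1))
    Order                  : Fin s → ℕ → L.Carrier → Set (c ⊔ ℓ)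
    order-resp             : ∀ {a m p p′} → p L.≈ p′ → Order a m p′ → Order a m p
    order-weaken           : ∀ {a m n p} → m ℕ.≤ n → Order a n p → Order a m p
    order-0                : ∀ {a m} → Order a m L.0#
    order-+                : ∀ {a m p p′} → Order a m p → Order a m p′ → Order a m (p L.+ p′)
    order-neg              : ∀ {a m p} → Order a m p → Order a m (L.- p)
    order-*                : ∀ {a m n p p′} → Order a m p → Order a n p′ → Order a (m ℕ.+ n) (p L.* p′)
    order-constant         : ∀ {a} r → Order a 0 (constant r)
    order-var-same         : ∀ {a} → Order a 1 (var a)
    order-var              : ∀ {a i} → a ≢ i → Order a 0 (var i)
    order-var⁻¹            : ∀ {a i} → a ≢ i → Order a 0 (var⁻¹ i)
    order-vanish           : ∀ {a m p} → Order a m p → ∀ k → lookup k a ℤ.< + m → coefficient p k ≈ 0#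

module LaurentModel {c ℓ} (R : CommutativeRing c ℓ) (s : ℕ) where
  open CommutativeRing R hiding (zero)
  open Laurent R s
  open LaurentRing R s
  private
    module L = CommutativeRing laurentRing

  coefficient-constant : ∀ r k → coefficient (constant r) k ≈ r * coefficient L.1# k
  coefficient-constant r k with does (Vec.≡-dec ℤ._≟_ 𝟘 k)
  ... | true  = trans (+-identityʳ _) (sym (trans (*-congˡ (+-identityʳ _)) (*-identityʳ _)))
  ... | false = trans (+-identityʳ _) (sym (trans (*-congˡ (+-identityʳ _)) (zeroʳ _)))

  constant-cong : ∀ {r r′} → r ≈ r′ → constant r L.≈ constant r′
  constant-cong r≈r′ k = trans (coefficient-constant _ k)
    (trans (*-congʳ r≈r′) (sym (coefficient-constant _ k)))

  var-inverse : ∀ i → var i L.* var⁻¹ i L.≈ L.1#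
  var-inverse i k = trans
    (reflexive (≡.cong (λ e → coefficient ((1# * 1# , e) ∷ []) k)
                       (≡.trans (⊕-power i (+ 1) -[1+ 0 ]) (power-zero i))))
    (constant-cong (*-identityʳ 1#) k)

  Supported : Fin s → ℕ → List Term → Set c
  Supported a m = All (λ t → + m ℤ.≤ lookup (proj₂ t) a)

  -- A list may contain low terms that cancel, so support is required only of some list with the
  -- same coefficients. This makes the order a property of the polynomial.
  Order : Fin s → ℕ → List Term → Set (c ⊔ ℓ)
  Order a m p = ∃[ p′ ] p L.≈ p′ × Supported a m p′

  supported-* : ∀ {a m n w w′} → Supported a m w → Supported a n w′ → Supported a (m ℕ.+ n) (w L.* w′)
  supported-* []                    supp′ = []
  supported-* {a} {m} {n} {t ∷ w} (≤t ∷ supp) supp′ = All.++⁺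
    (All.map⁺ (All.map (λ {t′} ≤t′ → ≡.subst (+ (m ℕ.+ n) ℤ.≤_)
      (≡.sym (Vec.lookup-zipWith ℤ._+_ a (proj₂ t) (proj₂ t′))) (ℤ.+-mono-≤ ≤t ≤t′)) supp′))
    (supported-* supp supp′)

  supported-vanish : ∀ {a m w} → Supported a m w → ∀ k → lookup k a ℤ.< + m → coefficient w k ≈ 0#
  supported-vanish []           k k<m = refl
  supported-vanish {a} {m} {(r , e) ∷ w} (m≤e ∷ supp) k k<m = trans
    (+-cong (reflexive (if-no (Vec.≡-dec ℤ._≟_ e k)
              (λ e≡k → ℤ.<⇒≱ k<m (≡.subst (λ l → + m ℤ.≤ lookup l a) e≡k m≤e))))
            (supported-vanish supp k k<m))
    (+-identityʳ 0#)

  bounded : ∀ i p → ∃[ N ] (∀ k → N ℤ.≤ lookup k i → coefficient p k ≈ 0#)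
  bounded i []            = + 0 , λ _ _ → refl
  bounded i ((r , e) ∷ p) with bounded i p
  ... | N , vanish = ℤ.suc (lookup e i) ℤ.⊔ N , λ k ≤k → trans
    (+-cong (reflexive (if-no (Vec.≡-dec ℤ._≟_ e k)
              (λ e≡k → ℤ.<⇒≱ (ℤ.suc[i]≤j⇒i<j ℤ.≤-refl) (ℤ.≤-trans (ℤ.i≤i⊔j _ N)
                (≡.subst (λ l → _ ℤ.≤ lookup l i) (≡.sym e≡k) ≤k)))))
            (vanish k (ℤ.≤-trans (ℤ.i≤j⊔i (ℤ.suc (lookup e i)) N) ≤k)))
    (+-identityʳ 0#)

  laurentAlgebra : LaurentAlgebra R s
  laurentAlgebra = record
    { polynomials            = laurentRing
    ; coefficient            = coefficient
    ; coefficient-cong       = λ eq → eq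
    ; coefficient-+          = coefficient-++
    ; coefficient-0          = λ k → refl
    ; coefficient-1          = trans (+-identityʳ _) (reflexive (if-yes (Vec.≡-dec ℤ._≟_ (𝟘 {s}) 𝟘) ≡.refl))
    ; extensional            = λ eq → eq
    ; bounded                = bounded
    ; constant               = constant
    ; constant-1             = λ k → refl
    ; constant-neg           = λ r k → refl
    ; coefficient-constant   = coefficient-constant
    ; coefficient-constant-* = coefficient-constant-*
    ; var                    = var
    ; var⁻¹                  = var⁻¹
    ; var-inverse            = var-inverse
    ; coefficient-var-*      = λ i p k → trans (coefficient-monomial-* 1# (power i (+ 1)) p k) (*-identityˡ _)
    ; Order                  = Order
    ; order-resp             = λ { eq (w , eq′ , supp) → w , (λ k → trans (eq k) (eq′ k)) , supp }
    ; order-weaken           = λ { m≤n (w , eq , supp) → w , eq , All.map (ℤ.≤-trans (ℤ.+≤+ m≤n)) supp }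
    ; order-0                = [] , (λ k → refl) , []
    ; order-+                = λ { {p = p} {p′} (w , eq , supp) (w′ , eq′ , supp′) →
                                   w ++ w′ , L.+-cong {p} {w} {p′} {w′} eq eq′ , All.++⁺ supp supp′ }
    ; order-neg              = λ { {p = p} (w , eq , supp) → L.- w , L.-‿cong {p} {w} eq , All.map⁺ supp }
    ; order-*                = λ { {p = p} {p′} (w , eq , supp) (w′ , eq′ , supp′) →
                                   w L.* w′ , L.*-cong {p} {w} {p′} {w′} eq eq′ , supported-* supp supp′ }
    ; order-constant         = λ {a} r → constant r , (λ k → refl) , ℤ.≤-reflexive (≡.sym (Vec.lookup-replicate a (+ 0))) ∷ []
    ; order-var-same         = λ {a} → var a , (λ k → refl) , ℤ.≤-reflexive (≡.sym (lookup-power-same a (+ 1))) ∷ []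
    ; order-var              = λ {a} {i} a≢i → var i , (λ k → refl) , ℤ.≤-reflexive (≡.sym (lookup-power-other a≢i (+ 1))) ∷ []
    ; order-var⁻¹            = λ {a} {i} a≢i → var⁻¹ i , (λ k → refl) , ℤ.≤-reflexive (≡.sym (lookup-power-other a≢i -[1+ 0 ])) ∷ []
    ; order-vanish           = λ { (w , eq , supp) k k<m → trans (eq k) (supported-vanish supp k k<m) }
    }

-- Values at z_a = 0, constant terms, separation of variables.

module LaurentTheory {c ℓ} {R : CommutativeRing c ℓ} {s : ℕ} (𝓛 : LaurentAlgebra R s) where
  open CommutativeRing R hiding (zero)
  open RingLemmas R
  open LaurentAlgebra 𝓛
  private
    module LL = RingLemmas polynomials
    module LQ = QPochhammer L.rawRing

  power : Fin s → ℤ → Vec ℤ s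
  power a m = 𝟘 [ a ]≔ m

  constant-cong : ∀ {r r′} → r ≈ r′ → constant r L.≈ constant r′
  constant-cong r≈r′ = extensional λ k → trans (coefficient-constant _ k)
    (trans (*-congʳ r≈r′) (sym (coefficient-constant _ k)))

  constant-* : ∀ r r′ → constant r L.* constant r′ L.≈ constant (r * r′)
  constant-* r r′ = extensional λ k → begin
    coefficient (constant r L.* constant r′) k  ≈⟨ coefficient-constant-* r (constant r′) k ⟩
    r * coefficient (constant r′) k             ≈⟨ *-congˡ (coefficient-constant r′ k) ⟩
    r * (r′ * coefficient L.1# k)               ≈⟨ *-assoc _ _ _ ⟨
    r * r′ * coefficient L.1# k                 ≈⟨ coefficient-constant (r * r′) k ⟨
    coefficient (constant (r * r′)) k           ∎

  constant-+ : ∀ r r′ → constant r L.+ constant r′ L.≈ constant (r + r′)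
  constant-+ r r′ = extensional λ k → begin
    coefficient (constant r L.+ constant r′) k            ≈⟨ coefficient-+ (constant r) (constant r′) k ⟩
    coefficient (constant r) k + coefficient (constant r′) k
      ≈⟨ +-cong (coefficient-constant r k) (coefficient-constant r′ k) ⟩
    r * coefficient L.1# k + r′ * coefficient L.1# k      ≈⟨ distribʳ _ _ _ ⟨
    (r + r′) * coefficient L.1# k                         ≈⟨ coefficient-constant (r + r′) k ⟨
    coefficient (constant (r + r′)) k                     ∎

  constant-^ : ∀ r n → constant r LL.^ n L.≈ constant (r ^ n)
  constant-^ r zero    = L.sym constant-1
  constant-^ r (suc n) = L.trans (L.*-congˡ (constant-^ r n)) (constant-* r (r ^ n))

  constant-∏ : ∀ {a} {X : Set a} (f : X → Carrier) xs → LL.∏ (constant ∘ f) xs L.≈ constant (∏ f xs)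
  constant-∏ f []       = L.sym constant-1
  constant-∏ f (x ∷ xs) = L.trans (L.*-congˡ (constant-∏ f xs)) (constant-* (f x) _)

  constant-inverse : ∀ {x y} → x * y ≈ 1# → constant x L.* constant y L.≈ L.1#
  constant-inverse {x} {y} xy≈1 = L.trans (constant-* x y) (L.trans (constant-cong xy≈1) constant-1)

  coefficient-var^-* : ∀ a n p → coefficient (var a LL.^ n L.* p) (power a (+ n)) ≈ coefficient p 𝟘
  coefficient-var^-* a zero    p =
    trans (coefficient-cong (L.*-identityˡ p) (power a (+ 0))) (reflexive (≡.cong (coefficient p) (power-zero a)))
  coefficient-var^-* a (suc n) p = begin
    coefficient (var a L.* var a LL.^ n L.* p) (power a (+ suc n))
      ≈⟨ coefficient-cong (L.*-assoc (var a) (var a LL.^ n) p) (power a (+ suc n)) ⟩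
    coefficient (var a L.* (var a LL.^ n L.* p)) (power a (+ suc n))
      ≈⟨ coefficient-var-* a (var a LL.^ n L.* p) (power a (+ suc n)) ⟩
    coefficient (var a LL.^ n L.* p) (power a (+ suc n) ⊖ power a (+ 1))
      ≡⟨ ≡.cong (coefficient (var a LL.^ n L.* p))
           (≡.trans (≡.cong (_⊖ power a (+ 1)) (≡.sym (⊕-power a (+ 1) (+ n)))) (⊕-⊖-cancel (power a (+ 1)) (power a (+ n)))) ⟩
    coefficient (var a LL.^ n L.* p) (power a (+ n))
      ≈⟨ coefficient-var^-* a n p ⟩
    coefficient p 𝟘 ∎

  module _ {a : Fin s} where

    order-1 : Order a 0 L.1#
    order-1 = order-resp (L.sym constant-1) (order-constant 1#)

    order-^ : ∀ {p} → Order a 0 p → ∀ n → Order a 0 (p LL.^ n)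
    order-^ o zero    = order-1
    order-^ o (suc n) = order-* o (order-^ o n)

    order-var^ : ∀ n → Order a n (var a LL.^ n)
    order-var^ zero    = order-1
    order-var^ (suc n) = order-* order-var-same (order-var^ n)

    order-∏ : ∀ {b} {X : Set b} {f : X → L.Carrier} xs → (∀ {x} → x ∈ xs → Order a 0 (f x)) → Order a 0 (LL.∏ f xs)
    order-∏ []       o = order-1
    order-∏ (x ∷ xs) o = order-* (o (here ≡.refl)) (order-∏ xs (o ∘ there))

    order-⟨⟩ : ∀ {z q} → Order a 0 z → Order a 0 q → ∀ n → Order a 0 (LQ.⟨ z ︔ q ⟩ n)
    order-⟨⟩ oz oq zero    = order-1
    order-⟨⟩ oz oq (suc n) = order-* (order-⟨⟩ oz oq n)
      (order-+ (order-1) (order-neg (order-* (order-^ oq n) oz)))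

  -- p takes the constant value r at z_a = 0.
  Lead : Fin s → L.Carrier → Carrier → Set _
  Lead a p r = ∃[ w ] Order a 1 w × p L.≈ constant r L.+ w

  module _ {a : Fin s} where

    lead-constant : ∀ r → Lead a (constant r) r
    lead-constant r = L.0# , order-0 , L.sym (L.+-identityʳ (constant r))

    lead-resp : ∀ {p p′ r r′} → p L.≈ p′ → r′ ≈ r → Lead a p′ r′ → Lead a p r
    lead-resp p≈p′ r′≈r (w , ow , eq) = w , ow , L.trans p≈p′ (L.trans eq (L.+-congʳ (constant-cong r′≈r)))

    lead-1 : Lead a L.1# 1#
    lead-1 = lead-resp (L.sym constant-1) refl (lead-constant 1#)

    lead-order : ∀ {p r} → Lead a p r → Order a 0 p
    lead-order {r = r} (w , ow , eq) = order-resp eq (order-+ (order-constant r) (order-weaken ℕ.z≤n ow))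

    lead-+ : ∀ {p r p′} → Lead a p r → Order a 1 p′ → Lead a (p L.+ p′) r
    lead-+ {r = r} {p′} (w , ow , eq) op′ = w L.+ p′ , order-+ ow op′ ,
      L.trans (L.+-congʳ eq) (L.+-assoc (constant r) w p′)

    lead-* : ∀ {p p′ r r′} → Lead a p r → Lead a p′ r′ → Lead a (p L.* p′) (r * r′)
    lead-* {p} {p′} {r} {r′} (w , ow , eq) l′@(w′ , ow′ , eq′) =
      constant r L.* w′ L.+ w L.* p′ ,
      order-+ (order-* (order-constant r) ow′) (order-* ow (lead-order l′)) ,
      (LL.begin
        p L.* p′
          LL.≈⟨ L.*-congʳ eq ⟩
        (constant r L.+ w) L.* p′
          LL.≈⟨ L.distribʳ p′ (constant r) w ⟩
        constant r L.* p′ L.+ w L.* p′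
          LL.≈⟨ L.+-congʳ (L.trans (L.*-congˡ {constant r} eq′) (L.distribˡ (constant r) (constant r′) w′)) ⟩
        constant r L.* constant r′ L.+ constant r L.* w′ L.+ w L.* p′
          LL.≈⟨ L.+-assoc (constant r L.* constant r′) (constant r L.* w′) (w L.* p′) ⟩
        constant r L.* constant r′ L.+ (constant r L.* w′ L.+ w L.* p′)
          LL.≈⟨ L.+-congʳ (constant-* r r′) ⟩
        constant (r * r′) L.+ (constant r L.* w′ L.+ w L.* p′) LL.∎)

    lead-∏ : ∀ {b} {X : Set b} {f : X → L.Carrier} {g : X → Carrier} xs →
             (∀ {x} → x ∈ xs → Lead a (f x) (g x)) → Lead a (LL.∏ f xs) (∏ g xs)
    lead-∏ []       l = lead-1
    lead-∏ (x ∷ xs) l = lead-* (l (here ≡.refl)) (lead-∏ xs (l ∘ there))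

    module _ (q : Carrier) where
      open QCalculus polynomials (constant q)

      lead-⟨⟩ : ∀ {z} → Order a 1 z → ∀ n → Lead a (LQ.⟨ z ︔ constant q ⟩ n) 1#
      lead-⟨⟩ oz zero    = lead-1
      lead-⟨⟩ oz (suc n) = lead-resp L.refl (*-identityʳ 1#) (lead-* (lead-⟨⟩ oz n)
        (lead-+ lead-1 (order-neg (order-* (order-^ (order-constant q) n) oz))))

      -- At y = 0 each of the t factors is q^C. Since this value is exponential in t, the sum over
      -- the nodes of one variable will involve only powers of q^b.
      lead-shifted : ∀ C {y} → Order a 1 y → ∀ t → Lead a (shifted C y t) ((q ^ C) ^ t)
      lead-shifted C oy zero    = lead-1
      lead-shifted C oy (suc t) = lead-resp L.refl (*-comm _ _) (lead-* (lead-shifted C oy t)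
        (lead-+ (lead-resp (constant-^ q C) refl (lead-constant (q ^ C)))
                (order-neg (order-* (order-^ (order-constant q) t) oy))))

      lead-quotient : ∀ B C {y} → Order a 1 y → ∀ t → Lead a (quotient B C y t) ((q ^ C) ^ t)
      lead-quotient B C oy t = lead-resp L.refl (*-identityʳ _) (lead-* (lead-shifted C oy t)
        (lead-⟨⟩ (order-* (order-^ (order-constant q) t) oy) (B ∸ t)))

    -- Modulo z_a the factor p is the constant r. The rest of p has order 1 in z_a and p′ has order
    -- 0, so their product has no constant term.
    coefficient-lead : ∀ {p r p′} → Lead a p r → Order a 0 p′ → ∀ n →
                       coefficient (p L.* p′ L.* var a LL.^ n) (power a (+ n)) ≈ r * coefficient p′ 𝟘
    coefficient-lead {p} {r} {p′} (w , ow , eq) op′ n = begin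
      coefficient (p L.* p′ L.* var a LL.^ n) (power a (+ n))
        ≈⟨ coefficient-cong (L.*-comm (p L.* p′) (var a LL.^ n)) (power a (+ n)) ⟩
      coefficient (var a LL.^ n L.* (p L.* p′)) (power a (+ n))
        ≈⟨ coefficient-var^-* a n (p L.* p′) ⟩
      coefficient (p L.* p′) 𝟘
        ≈⟨ coefficient-cong (L.trans (L.*-congʳ {p′} eq) (L.distribʳ p′ (constant r) w)) 𝟘 ⟩
      coefficient (constant r L.* p′ L.+ w L.* p′) 𝟘
        ≈⟨ coefficient-+ (constant r L.* p′) (w L.* p′) 𝟘 ⟩
      coefficient (constant r L.* p′) 𝟘 + coefficient (w L.* p′) 𝟘
        ≈⟨ +-cong (coefficient-constant-* r p′ 𝟘)
                  (order-vanish (order-* ow op′) 𝟘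
                    (≡.subst (ℤ._< + 1) (≡.sym (Vec.lookup-replicate a (+ 0))) (ℤ.+<+ (ℕ.s≤s ℕ.z≤n)))) ⟩
      r * coefficient p′ 𝟘 + 0#
        ≈⟨ +-identityʳ _ ⟩
      r * coefficient p′ 𝟘 ∎

  -- The relation moves coefficients along the direction z_i/z_j, eventually
  -- beyond the finite support of x.
  var-separated : ∀ {i j} → i ≢ j → ∀ {g g⁻¹} g′ → g * g⁻¹ ≈ 1# → ∀ x →
                  constant g L.* var i L.* x L.≈ constant g′ L.* var j L.* x → x L.≈ L.0#
  var-separated {i} {j} i≢j {g} {g⁻¹} g′ gg⁻¹≈1 x eq = extensional λ k → trans (far ℤ.∣ N ℤ.- lookup k i ∣ k (N≤ k)) (sym (coefficient-0 k))
    where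
    N : ℤ
    N = proj₁ (bounded i x)

    coefficient-side : ∀ g i k → coefficient (constant g L.* var i L.* x) k ≈ g * coefficient x (k ⊖ power i (+ 1))
    coefficient-side g i k = begin
      coefficient (constant g L.* var i L.* x) k    ≈⟨ coefficient-cong (L.*-assoc (constant g) (var i) x) k ⟩
      coefficient (constant g L.* (var i L.* x)) k  ≈⟨ coefficient-constant-* g (var i L.* x) k ⟩
      g * coefficient (var i L.* x) k               ≈⟨ *-congˡ (coefficient-var-* i x k) ⟩
      g * coefficient x (k ⊖ power i (+ 1))         ∎

    next : Vec ℤ s → Vec ℤ s
    next k = (power i (+ 1) ⊕ k) ⊖ power j (+ 1)

    lookup-next : ∀ k → lookup (next k) i ≡ ℤ.suc (lookup k i)
    lookup-next k = ≡.trans (Vec.lookup-zipWith ℤ._-_ i (power i (+ 1) ⊕ k) (power j (+ 1)))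
      (≡.trans (≡.cong₂ ℤ._-_ (≡.trans (Vec.lookup-zipWith ℤ._+_ i (power i (+ 1)) k) (≡.cong (ℤ._+ lookup k i) (lookup-power-same i (+ 1))))
                               (lookup-power-other i≢j (+ 1)))
               (ℤ.+-identityʳ _))

    -- Both sides of the relation are compared at the exponent of z_i z^k. On the left this isolates
    -- the coefficient at k, multiplied by the unit g.
    step : ∀ k → coefficient x (next k) ≈ 0# → coefficient x k ≈ 0#
    step k next≈0 = unit-cancel gg⁻¹≈1 (begin
      g * coefficient x k
        ≡⟨ ≡.cong (λ l → g * coefficient x l) (⊕-⊖-cancel (power i (+ 1)) k) ⟨
      g * coefficient x ((power i (+ 1) ⊕ k) ⊖ power i (+ 1))
        ≈⟨ trans (sym (coefficient-side g i _)) (trans (coefficient-cong eq (power i (+ 1) ⊕ k)) (coefficient-side g′ j _)) ⟩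
      g′ * coefficient x (next k)
        ≈⟨ trans (*-congˡ next≈0) (zeroʳ g′) ⟩
      0# ∎)

    far : ∀ n k → N ℤ.≤ + n ℤ.+ lookup k i → coefficient x k ≈ 0#
    far zero    k N≤k = proj₂ (bounded i x) k (≡.subst (N ℤ.≤_) (ℤ.+-identityˡ _) N≤k)
    far (suc n) k N≤k = step k (far n (next k) (≡.subst (N ℤ.≤_) shift N≤k))
      where
      shift : + suc n ℤ.+ lookup k i ≡ + n ℤ.+ lookup (next k) i
      shift = ≡.trans (≡.cong (ℤ._+ lookup k i) (ℤ.+-comm (+ 1) (+ n)))
        (≡.trans (ℤ.+-assoc (+ n) (+ 1) (lookup k i)) (≡.cong (ℤ._+_ (+ n)) (≡.sym (lookup-next k))))

    N≤ : ∀ k → N ℤ.≤ + ℤ.∣ N ℤ.- lookup k i ∣ ℤ.+ lookup k i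
    N≤ k = ≡.subst (ℤ._≤ + ℤ.∣ N ℤ.- lookup k i ∣ ℤ.+ lookup k i)
      (≡.trans (ℤ.+-assoc N _ _) (≡.trans (≡.cong (ℤ._+_ N) (ℤ.+-inverseˡ (lookup k i))) (ℤ.+-identityʳ N)))
      (ℤ.+-monoˡ-≤ (lookup k i) (i≤∣i∣ (N ℤ.- lookup k i)))

-- The Dyson product and the nodes q^b z_i.

module DysonProduct {c ℓ} {R : CommutativeRing c ℓ} {s : ℕ} (𝓛 : LaurentAlgebra R s)
  (q : CommutativeRing.Carrier R) (β : Fin s → ℕ) where
  open LaurentAlgebra 𝓛
  open CommutativeRing polynomials hiding (zero)
  open RingLemmas polynomials
  open LaurentTheory 𝓛
  open QPochhammer rawRing
  open Without {X = Fin s} Fin._≟_ public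

  qᴸ : Carrier
  qᴸ = constant q

  factor : Fin s → Fin s → Carrier
  factor i j =
    if does (i Fin.<? j)
    then (⟨ var i * var⁻¹ j ︔ qᴸ ⟩ β i) * (⟨ qᴸ * (var j * var⁻¹ i) ︔ qᴸ ⟩ β j)
    else 1#

  factor-< : ∀ {i j} → i Fin.< j →
             factor i j ≈ (⟨ var i * var⁻¹ j ︔ qᴸ ⟩ β i) * (⟨ qᴸ * (var j * var⁻¹ i) ︔ qᴸ ⟩ β j)
  factor-< {i} {j} i<j = reflexive (if-yes (i Fin.<? j) i<j)

  factor-≮ : ∀ {i j} → ¬ (i Fin.< j) → factor i j ≈ 1#
  factor-≮ {i} {j} i≮j = reflexive (if-no (i Fin.<? j) i≮j)

  -- The Laurent factor for a sublist of the variables, as the induction on their number requires.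
  -- All index pairs may be used, since `factor` is 1 unless i < j.
  dyson : List (Fin s) → Carrier
  dyson J = ∏ (λ i → ∏ (factor i) J) J

  pair : Fin s → Fin s → Carrier
  pair a j = factor a j * factor j a

  dyson-without : ∀ {J a} → Unique J → a ∈ J → dyson J ≈ ∏ (pair a) J * dyson (without a J)
  dyson-without {J} {a} unique a∈J = begin
    ∏ (λ i → ∏ (factor i) J) J
      ≈⟨ Prod.fold-cong J (λ {i} _ → extract (factor i)) ⟩
    ∏ (λ i → factor i a * ∏ (factor i) J′) J
      ≈⟨ Prod.fold-∙ (λ i → factor i a) (λ i → ∏ (factor i) J′) J ⟩
    ∏ (λ i → factor i a) J * ∏ (λ i → ∏ (factor i) J′) J
      ≈⟨ *-congˡ (extract (λ i → ∏ (factor i) J′)) ⟩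
    ∏ (λ i → factor i a) J * (∏ (factor a) J′ * dyson J′)
      -- The diagonal factor is 1, so row a may run over all of `J`.
      ≈⟨ *-congˡ (*-congʳ (trans (sym (*-identityˡ _)) (trans (*-congʳ (sym (factor-≮ (Fin.<-irrefl ≡.refl)))) (sym (extract (factor a)))))) ⟩
    ∏ (λ i → factor i a) J * (∏ (factor a) J * dyson J′)
      ≈⟨ solve 3 (λ x y z → x :* (y :* z) := y :* x :* z) refl _ _ _ ⟩
    ∏ (factor a) J * ∏ (λ i → factor i a) J * dyson J′
      ≈⟨ *-congʳ (Prod.fold-∙ (factor a) (λ i → factor i a) J) ⟨
    ∏ (pair a) J * dyson J′ ∎
    where
    J′ : List (Fin s)
    J′ = without a J
    extract : ∀ f → ∏ f J ≈ f a * ∏ f J′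
    extract f = Prod.fold-without Fin._≟_ f unique a∈J

  ∈-without⁻ : ∀ {a j J} → j ∈ without a J → a ≢ j
  ∈-without⁻ {a} {j} {J} j∈ a≡j = proj₂ (∈-filter⁻ (λ y → ¬? (y Fin.≟ a)) {xs = J} j∈) (≡.sym a≡j)

  order-factor : ∀ {a i j} → a ≢ i → a ≢ j → Order a 0 (factor i j)
  order-factor {a} {i} {j} a≢i a≢j with does (i Fin.<? j)
  ... | false = order-1
  ... | true  = order-*
    (order-⟨⟩ (order-* (order-var a≢i) (order-var⁻¹ a≢j)) (order-constant q) (β i))
    (order-⟨⟩ (order-* (order-constant q) (order-* (order-var a≢j) (order-var⁻¹ a≢i))) (order-constant q) (β j))

  order-dyson-without : ∀ {a} J → Order a 0 (dyson (without a J))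
  order-dyson-without {a} J = order-∏ (without a J) λ i∈ → order-∏ (without a J) λ j∈ →
    order-factor (∈-without⁻ {J = J} i∈) (∈-without⁻ {J = J} j∈)

  Key : Set
  Key = Fin s × ℕ

  _≟ₖ_ : DecidableEquality Key
  _≟ₖ_ = Product.≡-dec Fin._≟_ ℕ._≟_

  keys : List (Fin s) → List Key
  keys = concatMap (λ j → map (j ,_) (upTo (β j)))

  node : Key → Carrier
  node (i , b) = qᴸ ^ b * var i

  ∈-keys⁻ : ∀ {a b} J → (a , b) ∈ keys J → a ∈ J × b < β a
  ∈-keys⁻ J ab∈ with find (∈-concatMap⁻ (λ j → map (j ,_) (upTo (β j))) {xs = J} ab∈)
  ... | j , j∈J , ab∈j with ∈-map⁻ (j ,_) ab∈j
  ...   | c , c∈ , ≡.refl = j∈J , ∈-upTo⁻ c∈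

  ∈-keys⁺ : ∀ {a b J} → a ∈ J → b < β a → (a , b) ∈ keys J
  ∈-keys⁺ {a} a∈J b<β = ∈-concatMap⁺ (λ j → map (j ,_) (upTo (β j))) (lose a∈J (∈-map⁺ (a ,_) (∈-upTo⁺ b<β)))

  keys-unique : ∀ {J} → Unique J → Unique (keys J)
  keys-unique []                    = []
  keys-unique {j ∷ J} (j∉J ∷ unique) = Unique.++⁺
    (Unique.map⁺ (λ eq → proj₂ (Product.,-injective eq)) (Unique.upTo⁺ (β j)))
    (keys-unique unique)
    λ {(a , b)} (ab∈j , ab∈J) → All.lookup j∉J (proj₁ (∈-keys⁻ J ab∈J)) (first ab∈j)
    where
    first : ∀ {a b} → (a , b) ∈ map (j ,_) (upTo (β j)) → j ≡ a
    first ab∈ with ∈-map⁻ (j ,_) ab∈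
    ... | _ , _ , ≡.refl = ≡.refl

  ∑-keys : ∀ f J → ∑ f (keys J) ≈ ∑ (λ a → ∑ (λ b → f (a , b)) (upTo (β a))) J
  ∑-keys f J = trans (Sum.fold-concatMap f _ J) (Sum.fold-cong J (λ {j} _ → Sum.fold-map f (j ,_) (upTo (β j))))

  ∏-keys : ∀ f J → ∏ f (keys J) ≈ ∏ (λ a → ∏ (λ b → f (a , b)) (upTo (β a))) J
  ∏-keys f J = trans (Prod.fold-concatMap f _ J) (Prod.fold-cong J (λ {j} _ → Prod.fold-map f (j ,_) (upTo (β j))))

-- Partial fractions for the Dyson product.

module PartialFractions {c ℓ} {R : CommutativeRing c ℓ} {s : ℕ} (𝓛 : LaurentAlgebra R s)
  {q : CommutativeRing.Carrier R} (generic : IsGeneric R q) (β : Fin s → ℕ) where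
  open LaurentAlgebra 𝓛
  open CommutativeRing polynomials hiding (zero)
  open RingLemmas polynomials
  open LaurentTheory 𝓛
  open QPochhammer rawRing
  open DysonProduct 𝓛 q β
  open QCalculus polynomials qᴸ
  open IsGeneric generic
  private
    module R = CommutativeRing R
    module RL = RingLemmas R
    module RD = Lagrange R ℕ._≟_ (q RL.^_) (r RL.^_)
  open QUnits R generic using (κ⁻¹; κ⁻¹-inverse)

  rᴸ : Carrier
  rᴸ = constant r

  qᴸrᴸ≈1 : qᴸ * rᴸ ≈ 1#
  qᴸrᴸ≈1 = constant-inverse qr≈1

  constant-1- : ∀ x → constant (R.1# R.- x) ≈ 1# - constant x
  constant-1- x = begin
    constant (R.1# R.- x)              ≈⟨ constant-+ R.1# (R.- x) ⟨
    constant R.1# + constant (R.- x)   ≈⟨ +-cong constant-1 (constant-neg x) ⟩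
    1# - constant x                    ∎

  genericᴸ : IsGeneric polynomials qᴸ
  genericᴸ = record
    { r    = rᴸ
    ; qr≈1 = qᴸrᴸ≈1
    ; 1-q^ = λ e → constant (proj₁ (1-q^ e)) , (begin
        (1# - qᴸ ^ suc e) * constant (proj₁ (1-q^ e))
          ≈⟨ *-congʳ (trans (+-congˡ (-‿cong (constant-^ q (suc e)))) (sym (constant-1- _))) ⟩
        constant (R.1# R.- q RL.^ suc e) * constant (proj₁ (1-q^ e))
          ≈⟨ constant-inverse (proj₂ (1-q^ e)) ⟩
        1# ∎)
    }

  conode : Key → Carrier
  conode (i , b) = rᴸ ^ b * var⁻¹ i

  node-conode : ∀ k → node k * conode k ≈ 1#
  node-conode (i , b) = begin
    qᴸ ^ b * var i * (rᴸ ^ b * var⁻¹ i)    ≈⟨ interchange _ _ _ _ ⟩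
    qᴸ ^ b * rᴸ ^ b * (var i * var⁻¹ i)    ≈⟨ *-cong (inverse-^ qᴸrᴸ≈1 b) (var-inverse i) ⟩
    1# * 1#                              ≈⟨ *-identityʳ 1# ⟩
    1#                                   ∎

  -- Two nodes on one variable differ by the unit q^b - q^c times that variable. Nodes on different
  -- variables are separated by finiteness of support.
  node-separated : ∀ {k l} → k ≢ l → ∀ x → node k * x ≈ node l * x → x ≈ 0#
  node-separated {i , b} {j , c} k≢l x eq with i Fin.≟ j
  ... | yes ≡.refl = unit-cancel (var-inverse i)
    (QUnits.^-separated polynomials genericᴸ {b} {c} (λ b≡c → k≢l (≡.cong (i ,_) b≡c)) (var i * x)
      (trans (sym (*-assoc _ _ _)) (trans eq (*-assoc _ _ _))))
  ... | no i≢j = var-separated i≢j (q RL.^ c) (RL.inverse-^ qr≈1 b) x (begin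
    constant (q RL.^ b) * var i * x  ≈⟨ *-congʳ (*-congʳ (constant-^ q b)) ⟨
    qᴸ ^ b * var i * x                ≈⟨ eq ⟩
    qᴸ ^ c * var j * x                ≈⟨ *-congʳ (*-congʳ (constant-^ q c)) ⟩
    constant (q RL.^ c) * var j * x  ∎)

  open Lagrange polynomials _≟ₖ_ node conode

  ∏-⟨⟩ : ∀ z n → ∏ (λ c → 1# - qᴸ ^ c * z) (upTo n) ≈ ⟨ z ︔ qᴸ ⟩ n
  ∏-⟨⟩ z zero    = refl
  ∏-⟨⟩ z (suc n) = begin
    ∏ (λ c → 1# - qᴸ ^ c * z) (upTo (suc n))
      ≡⟨ ≡.cong (∏ _) (List.upTo-∷ʳ n) ⟨
    ∏ (λ c → 1# - qᴸ ^ c * z) (upTo n ++ n ∷ [])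
      ≈⟨ Prod.fold-++ _ (upTo n) (n ∷ []) ⟩
    ∏ (λ c → 1# - qᴸ ^ c * z) (upTo n) * ((1# - qᴸ ^ n * z) * 1#)
      ≈⟨ *-cong (∏-⟨⟩ z n) (*-identityʳ _) ⟩
    ⟨ z ︔ qᴸ ⟩ n * (1# - qᴸ ^ n * z) ∎

  ∏d-other : ∀ {a j} → a ≢ j → ∀ b {X} → X ≈ rᴸ ^ b * (var j * var⁻¹ a) →
             ∏ (λ c → d (a , b) (j , c)) (upTo (β j)) ≈ ⟨ X ︔ qᴸ ⟩ β j
  ∏d-other {a} {j} a≢j b {X} X≈ = trans (Prod.fold-cong (upTo (β j)) (λ {c} _ → pointwise c)) (∏-⟨⟩ X (β j))
    where
    pointwise : ∀ c → d (a , b) (j , c) ≈ 1# - qᴸ ^ c * X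
    pointwise c = trans (d-distinct (λ eq → a≢j (proj₁ (Product.,-injective eq))))
      (+-congˡ (-‿cong (trans
        (solve 4 (λ p v s w → p :* v :* (s :* w) := p :* (s :* (v :* w))) refl _ _ _ _)
        (*-congˡ (sym X≈)))))

  ∏d-same : ∀ a b → constant (κ⁻¹ (β a) b) * ∏ (λ c → d (a , b) (a , c)) (upTo (β a)) ≈ 1#
  ∏d-same a b = begin
    constant (κ⁻¹ (β a) b) * ∏ (λ c → d (a , b) (a , c)) (upTo (β a))
      ≈⟨ *-congˡ (trans (Prod.fold-cong (upTo (β a)) (λ {c} _ → pointwise c)) (constant-∏ (RD.d b) (upTo (β a)))) ⟩
    constant (κ⁻¹ (β a) b) * constant (RL.∏ (RD.d b) (upTo (β a)))
      ≈⟨ constant-inverse (κ⁻¹-inverse (β a) b) ⟩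
    1# ∎
    where
    pointwise : ∀ c → d (a , b) (a , c) ≈ constant (RD.d b c)
    pointwise c with b ℕ.≟ c
    ... | yes ≡.refl = trans (d-same (a , b)) (trans (sym constant-1) (constant-cong (R.sym (RD.d-same b))))
    ... | no b≢c = begin
      d (a , b) (a , c)
        ≈⟨ d-distinct (λ eq → b≢c (proj₂ (Product.,-injective eq))) ⟩
      1# - qᴸ ^ c * var a * (rᴸ ^ b * var⁻¹ a)
        ≈⟨ +-congˡ (-‿cong (trans (interchange _ _ _ _) (trans (*-congˡ (var-inverse a)) (*-identityʳ _)))) ⟩
      1# - qᴸ ^ c * rᴸ ^ b
        ≈⟨ +-congˡ (-‿cong (trans (*-cong (constant-^ q c) (constant-^ r b)) (constant-* _ _))) ⟩
      1# - constant (q RL.^ c R.* r RL.^ b)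
        ≈⟨ constant-1- _ ⟨
      constant (R.1# R.- q RL.^ c R.* r RL.^ b)
        ≈⟨ constant-cong (R.sym (RD.d-distinct b≢c)) ⟩
      constant (RD.d b c) ∎

  -- What remains of the pair {a,j} after division by (q^(-b) z_j/z_a;q)_{β_j}. For a < j the pair
  -- has y = z_a/z_j, and this base is q^(1-t)/y with t = b + 1. For j < a it has y = q z_a/z_j, and
  -- then t = b. The case j = a contributes the inverse of the constant factors 1 - q^(c-b).
  local : ∀ {a j : Fin s} → ℕ → Tri (a Fin.< j) (a ≡ j) (j Fin.< a) → Carrier
  local {a} {j} b (tri< _ _ _) = quotient (β a) (β j) (var a * var⁻¹ j) (suc b)
  local {a} {j} b (tri≈ _ _ _) = constant (κ⁻¹ (β a) b)
  local {a} {j} b (tri> _ _ _) = quotient (β a) (β j) (qᴸ * (var a * var⁻¹ j)) b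

  var-ratio : ∀ a j → var j * var⁻¹ a * (var a * var⁻¹ j) ≈ 1#
  var-ratio a j = begin
    var j * var⁻¹ a * (var a * var⁻¹ j)
      ≈⟨ solve 4 (λ x y z w → x :* y :* (z :* w) := z :* y :* (x :* w)) refl _ _ _ _ ⟩
    var a * var⁻¹ a * (var j * var⁻¹ j)
      ≈⟨ *-cong (var-inverse a) (var-inverse j) ⟩
    1# * 1#
      ≈⟨ *-identityʳ 1# ⟩
    1# ∎

  -- The poles of the partial fraction at q^b z_a that lie on z_j are all zeros
  -- of the pair factor.
  local-spec : ∀ {a j b} → b < β a → (t : Tri (a Fin.< j) (a ≡ j) (j Fin.< a)) →
               local b t * ∏ (λ c → d (a , b) (j , c)) (upTo (β j)) ≈ pair a j
  local-spec {a} {j} {b} b<β (tri< a<j a≢j j≮a) = begin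
    quotient (β a) (β j) (var a * var⁻¹ j) (suc b) * ∏ (λ c → d (a , b) (j , c)) (upTo (β j))
      ≈⟨ *-congˡ (∏d-other a≢j b (begin
           rᴸ * rᴸ ^ b * (qᴸ * x)      ≈⟨ solve 4 (λ s p q x → s :* p :* (q :* x) := q :* s :* (p :* x)) refl _ _ _ _ ⟩
           qᴸ * rᴸ * (rᴸ ^ b * x)      ≈⟨ trans (*-congʳ qᴸrᴸ≈1) (*-identityˡ _) ⟩
           rᴸ ^ b * x                ∎)) ⟩
    quotient (β a) (β j) (var a * var⁻¹ j) (suc b) * ⟨ rᴸ ^ suc b * (qᴸ * x) ︔ qᴸ ⟩ β j
      ≈⟨ quotient-spec qᴸrᴸ≈1 (var-ratio a j) (β j) b<β ⟩
    ⟨ var a * var⁻¹ j ︔ qᴸ ⟩ β a * ⟨ qᴸ * x ︔ qᴸ ⟩ β j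
      ≈⟨ trans (*-cong (factor-< a<j) (factor-≮ j≮a)) (*-identityʳ _) ⟨
    pair a j ∎
    where
    x : Carrier
    x = var j * var⁻¹ a
  local-spec {a} {b = b} b<β (tri≈ a≮a ≡.refl _) =
    trans (∏d-same a b) (sym (trans (*-cong (factor-≮ a≮a) (factor-≮ a≮a)) (*-identityʳ 1#)))
  local-spec {a} {j} {b} b<β (tri> a≮j a≢j j<a) = begin
    quotient (β a) (β j) y b * ∏ (λ c → d (a , b) (j , c)) (upTo (β j))
      ≈⟨ *-congˡ (∏d-other a≢j b (*-congˡ qᴸrᴸx≈x)) ⟩
    quotient (β a) (β j) y b * ⟨ rᴸ ^ b * (qᴸ * (rᴸ * x)) ︔ qᴸ ⟩ β j
      ≈⟨ quotient-spec qᴸrᴸ≈1 xy≈1 (β j) (ℕ.<⇒≤ b<β) ⟩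
    ⟨ y ︔ qᴸ ⟩ β a * ⟨ qᴸ * (rᴸ * x) ︔ qᴸ ⟩ β j
      ≈⟨ trans (*-congˡ (⟨⟩-cong qᴸrᴸx≈x (β j))) (*-comm _ _) ⟩
    ⟨ x ︔ qᴸ ⟩ β j * ⟨ y ︔ qᴸ ⟩ β a
      ≈⟨ trans (*-cong (factor-≮ a≮j) (factor-< j<a)) (*-identityˡ _) ⟨
    pair a j ∎
    where
    x y : Carrier
    x = var j * var⁻¹ a
    y = qᴸ * (var a * var⁻¹ j)
    qᴸrᴸx≈x : qᴸ * (rᴸ * x) ≈ x
    qᴸrᴸx≈x = trans (sym (*-assoc _ _ _)) (trans (*-congʳ qᴸrᴸ≈1) (*-identityˡ _))
    xy≈1 : rᴸ * x * y ≈ 1#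
    xy≈1 = begin
      rᴸ * x * (qᴸ * (var a * var⁻¹ j))
        ≈⟨ solve 4 (λ s x q y → s :* x :* (q :* y) := q :* s :* (x :* y)) refl _ _ _ _ ⟩
      qᴸ * rᴸ * (x * (var a * var⁻¹ j))
        ≈⟨ *-cong qᴸrᴸ≈1 (var-ratio a j) ⟩
      1# * 1#
        ≈⟨ *-identityʳ 1# ⟩
      1# ∎

  -- The quotient of `dyson J` by the product of 1 - u_l/u_k over the nodes l ≠ k, written without
  -- division. It is the weight for `lagrange` with L = `dyson J`.
  residue : List (Fin s) → Key → Carrier
  residue J (a , b) = ∏ (λ j → local b (Fin.<-cmp a j)) J * dyson (without a J)

  residue-spec : ∀ {J} → Unique J → ∀ {k} → k ∈ keys J → residue J k * ∏ (d k) (keys J) ≈ dyson J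
  residue-spec {J} unique {a , b} k∈ = begin
    ∏ E J * dyson (without a J) * ∏ (d (a , b)) (keys J)
      ≈⟨ *-congˡ (∏-keys (d (a , b)) J) ⟩
    ∏ E J * dyson (without a J) * ∏ D J
      ≈⟨ xy∙z≈xz∙y _ _ _ ⟩
    ∏ E J * ∏ D J * dyson (without a J)
      ≈⟨ *-congʳ (Prod.fold-∙ E D J) ⟨
    ∏ (λ j → E j * D j) J * dyson (without a J)
      ≈⟨ *-congʳ (Prod.fold-cong J (λ {j} _ → local-spec (proj₂ ab) (Fin.<-cmp a j))) ⟩
    ∏ (pair a) J * dyson (without a J)
      ≈⟨ dyson-without unique (proj₁ ab) ⟨
    dyson J ∎
    where
    ab : a ∈ J × b < β a
    ab = ∈-keys⁻ J k∈
    E D : Fin s → Carrier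
    E j = local b (Fin.<-cmp a j)
    D j = ∏ (λ c → d (a , b) (j , c)) (upTo (β j))

  summand : List (Fin s) → Fin s → ℕ → Carrier
  summand J a n = ∑ (λ b → residue J (a , b) * node (a , b) ^ n) (upTo (β a))

  -- The member k witnesses that there is a node at all: for an empty list of nodes `h` starts with
  -- 1, whereas the sum is 0.
  partialFractions : ∀ {J} → Unique J → ∀ {k} → k ∈ keys J → ∀ n →
                     dyson J * h (map node (keys J)) n ≈ ∑ (λ a → summand J a n) J
  partialFractions {J} unique k∈ n =
    trans (sym (nonempty (keys J) k∈ (keys-unique unique) (residue-spec unique))) (∑-keys _ J)
    where
    nonempty : ∀ ks {k} → k ∈ ks → Unique ks → (∀ {l} → l ∈ ks → residue J l * ∏ (d l) ks ≈ dyson J) →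
               ∑ (λ l → residue J l * node l ^ n) ks ≈ dyson J * h (map node ks) n
    nonempty (k ∷ ks) _ unique spec = lagrange node-conode node-separated unique (dyson J) (residue J) spec n

-- The coefficients and the q-Dyson identity.

module CoefficientFormula {c ℓ} {R : CommutativeRing c ℓ} {s : ℕ} (𝓛 : LaurentAlgebra R s)
  {q : CommutativeRing.Carrier R} (generic : IsGeneric R q) (β : Fin s → ℕ) (β>0 : ∀ i → 1 ≤ β i) where
  open CommutativeRing R hiding (zero)
  open RingLemmas R
  open LaurentAlgebra 𝓛
  open LaurentTheory 𝓛
  open QPochhammer rawRing
  open DysonProduct 𝓛 q β
  open PartialFractions 𝓛 generic β
  open QCalculus R q
  open QUnits R generic
  private
    module LL = RingLemmas polynomials
    module Nat = ListFold ℕ.+-0-commutativeMonoid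

  ∥_∥ : List (Fin s) → ℕ
  ∥_∥ = Nat.fold β

  later : Fin s → Fin s → ℕ
  later a j = if does (a Fin.<? j) then β j else 0

  tail : Fin s → List (Fin s) → ℕ
  tail a = Nat.fold (later a)

  CT : List (Fin s) → Carrier
  CT J = coefficient (dyson J) 𝟘

  localValue : ∀ {a j : Fin s} → ℕ → Tri (a Fin.< j) (a ≡ j) (j Fin.< a) → Carrier
  localValue {a} {j} b (tri< _ _ _) = (q ^ β j) ^ suc b
  localValue {a} {j} b (tri≈ _ _ _) = κ⁻¹ (β a) b
  localValue {a} {j} b (tri> _ _ _) = (q ^ β j) ^ b

  local-lead : ∀ {a j} b (t : Tri (a Fin.< j) (a ≡ j) (j Fin.< a)) → Lead a (local b t) (localValue b t)
  local-lead {a} {j} b (tri< _ a≢j _) =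
    lead-quotient q (β a) (β j) (order-* order-var-same (order-var⁻¹ a≢j)) (suc b)
  local-lead {a} {j} b (tri≈ _ _ _) = lead-constant _
  local-lead {a} {j} b (tri> _ a≢j _) =
    lead-quotient q (β a) (β j) (order-* (order-constant q) (order-* order-var-same (order-var⁻¹ a≢j))) b

  localValue-same : ∀ a b → localValue b (Fin.<-cmp a a) ≈ κ⁻¹ (β a) b
  localValue-same a b with Fin.<-cmp a a
  ... | tri< _ a≢a _ = ⊥-elim (a≢a ≡.refl)
  ... | tri≈ _ _ _   = refl
  ... | tri> _ a≢a _ = ⊥-elim (a≢a ≡.refl)

  localValue-other : ∀ {a j} → a ≢ j → ∀ b → localValue b (Fin.<-cmp a j) ≈ q ^ later a j * (q ^ b) ^ β j
  localValue-other {a} {j} a≢j b with Fin.<-cmp a j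
  ... | tri≈ _ a≡j _ = ⊥-elim (a≢j a≡j)
  ... | tri< a<j _ _ = *-cong (^-congʳ q (≡.sym (if-yes (a Fin.<? j) a<j))) (^-swap q (β j) b)
  ... | tri> a≮j _ _ = trans (sym (*-identityˡ _))
    (*-cong (^-congʳ q (≡.sym (if-no (a Fin.<? j) a≮j)))
            (^-swap q (β j) b))

  later-same : ∀ a → later a a ≡ 0
  later-same a = if-no (a Fin.<? a) (Fin.<-irrefl ≡.refl)

  -- The index j contributes q^{β_j t} with t = b + 1 for j after a and t = b for j before a. The
  -- common part collects into the power of q^b, the surplus into q to the power `tail a J`.
  ∏-localValue : ∀ {J a} → Unique J → a ∈ J → ∀ b →
    ∏ (λ j → localValue b (Fin.<-cmp a j)) J ≈ κ⁻¹ (β a) b * (q ^ tail a J * (q ^ b) ^ ∥ without a J ∥)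
  ∏-localValue {J} {a} unique a∈J b = begin
    ∏ (λ j → localValue b (Fin.<-cmp a j)) J
      ≈⟨ Prod.fold-without Fin._≟_ _ unique a∈J ⟩
    localValue b (Fin.<-cmp a a) * ∏ (λ j → localValue b (Fin.<-cmp a j)) J′
      ≈⟨ *-cong (localValue-same a b) (Prod.fold-cong J′ (λ j∈ → localValue-other (∈-without⁻ {J = J} j∈) b)) ⟩
    κ⁻¹ (β a) b * ∏ (λ j → q ^ later a j * (q ^ b) ^ β j) J′
      ≈⟨ *-congˡ (Prod.fold-∙ _ _ J′) ⟩
    κ⁻¹ (β a) b * (∏ (λ j → q ^ later a j) J′ * ∏ (λ j → (q ^ b) ^ β j) J′)
      ≈⟨ *-congˡ (*-cong (^-sum q (later a) J′) (^-sum (q ^ b) β J′)) ⟩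
    κ⁻¹ (β a) b * (q ^ tail a J′ * (q ^ b) ^ ∥ J′ ∥)
      ≈⟨ *-congˡ (*-congʳ (^-congʳ q (≡.sym tail≡))) ⟩
    κ⁻¹ (β a) b * (q ^ tail a J * (q ^ b) ^ ∥ J′ ∥) ∎
    where
    J′ : List (Fin s)
    J′ = without a J
    tail≡ : tail a J ≡ tail a J′
    tail≡ = ≡.trans (Nat.fold-without Fin._≟_ (later a) unique a∈J) (≡.cong (ℕ._+ tail a J′) (later-same a))

  node-^ : ∀ a b n → node (a , b) LL.^ n L.≈ constant ((q ^ b) ^ n) L.* var a LL.^ n
  node-^ a b n = L.trans (LL.^-distrib-* (qᴸ LL.^ b) (var a) n)
    (L.*-congʳ (L.trans (LL.^-congˡ n (constant-^ q b)) (constant-^ (q ^ b) n)))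

  order-∑ : ∀ {b} {X : Set b} {a m} {f : X → L.Carrier} xs → (∀ x → Order a m (f x)) → Order a m (LL.∑ f xs)
  order-∑ []       o = order-0
  order-∑ (x ∷ xs) o = order-+ (o x) (order-∑ xs o)

  coefficient-∑ : ∀ {b} {X : Set b} (f : X → L.Carrier) xs k →
                  coefficient (LL.∑ f xs) k ≈ ∑ (λ x → coefficient (f x) k) xs
  coefficient-∑ f []       k = coefficient-0 k
  coefficient-∑ f (x ∷ xs) k = trans (coefficient-+ _ _ k) (+-congˡ (coefficient-∑ f xs k))

  order-summand : ∀ J a n → Order a n (summand J a n)
  order-summand J a n = order-∑ (upTo (β a)) λ b → order-*
    (order-* (order-∏ J (λ {j} _ → lead-order (local-lead b (Fin.<-cmp a j)))) (order-dyson-without J))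
    (order-resp (node-^ a b n) (order-* (order-constant _) (order-var^ n)))

  -- In the b-th term the other variables contribute q^b to the power of their total weight and the
  -- node contributes (q^b)^n, so the sum over b is that of `∑κ⁻¹` with M the total of both
  -- exponents. Otherwise the other variables enter only through the constant term of their own
  -- Dyson product.
  coefficient-summand : ∀ {J a} → Unique J → a ∈ J → ∀ n →
    ⟨ q ︔ q ⟩ β a * coefficient (summand J a n) (power a (+ n)) ≈
    q ^ tail a J * (1# - q ^ β a) * ⟨ q ^ suc (∥ without a J ∥ ℕ.+ n) ︔ q ⟩ (β a ∸ 1) * CT (without a J)
  coefficient-summand {J} {a} unique a∈J n = begin
    ⟨ q ︔ q ⟩ β a * coefficient (summand J a n) (power a (+ n))
      ≈⟨ *-congˡ (trans (coefficient-∑ _ (upTo (β a)) _) (Sum.fold-cong (upTo (β a)) (λ {b} _ → term b))) ⟩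
    ⟨ q ︔ q ⟩ β a * ∑ (λ b → q ^ tail a J * CT J′ * (κ⁻¹ (β a) b * (q ^ b) ^ M)) (upTo (β a))
      ≈⟨ *-congˡ (sym (∑-distribˡ _ _ (upTo (β a)))) ⟩
    ⟨ q ︔ q ⟩ β a * (q ^ tail a J * CT J′ * ∑ (λ b → κ⁻¹ (β a) b * (q ^ b) ^ M) (upTo (β a)))
      ≈⟨ solve 4 (λ x y z w → x :* (y :* z :* w) := y :* z :* (x :* w)) refl _ _ _ _ ⟩
    q ^ tail a J * CT J′ * (⟨ q ︔ q ⟩ β a * ∑ (λ b → κ⁻¹ (β a) b * (q ^ b) ^ M) (upTo (β a)))
      ≈⟨ *-congˡ (total (β>0 a)) ⟩
    q ^ tail a J * CT J′ * ((1# - q ^ β a) * ⟨ q ^ suc M ︔ q ⟩ (β a ∸ 1))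
      ≈⟨ solve 4 (λ x y z w → x :* y :* (z :* w) := x :* z :* w :* y) refl _ _ _ _ ⟩
    q ^ tail a J * (1# - q ^ β a) * ⟨ q ^ suc M ︔ q ⟩ (β a ∸ 1) * CT J′ ∎
    where
    J′ : List (Fin s)
    J′ = without a J
    M : ℕ
    M = ∥ J′ ∥ ℕ.+ n

    -- For β_a = B + 1, the product (q;q)_{B+1} has one factor more than the denominator (q;q)_B of
    -- the Gaussian binomial coefficient. This is the factor 1 - q^{β_a} of the theorem.
    total : ∀ {B} → 1 ≤ B → ⟨ q ︔ q ⟩ B * ∑ (λ b → κ⁻¹ B b * (q ^ b) ^ M) (upTo B) ≈
                            (1# - q ^ B) * ⟨ q ^ suc M ︔ q ⟩ (B ∸ 1)
    total {suc B} _ = begin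
      ⟨ q ︔ q ⟩ B * (1# - q ^ B * q) * ∑ (λ b → κ⁻¹ (suc B) b * (q ^ b) ^ M) (upTo (suc B))
        ≈⟨ solve 3 (λ x y z → x :* y :* z := y :* (x :* z)) refl _ _ _ ⟩
      (1# - q ^ B * q) * (⟨ q ︔ q ⟩ B * ∑ (λ b → κ⁻¹ (suc B) b * (q ^ b) ^ M) (upTo (suc B)))
        ≈⟨ *-cong (+-congˡ (-‿cong (*-comm _ _))) (∑κ⁻¹ B M) ⟩
      (1# - q ^ suc B) * ⟨ q ^ suc M ︔ q ⟩ B ∎

    term : ∀ b → coefficient (residue J (a , b) L.* node (a , b) LL.^ n) (power a (+ n)) ≈
                 q ^ tail a J * CT J′ * (κ⁻¹ (β a) b * (q ^ b) ^ M)
    term b = begin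
      coefficient (residue J (a , b) L.* node (a , b) LL.^ n) (power a (+ n))
        ≈⟨ coefficient-cong (L.trans (L.*-congˡ (node-^ a b n))
             (LL.solve 4 (λ e d c v → e LL.:* d LL.:* (c LL.:* v) LL.:= c LL.:* e LL.:* d LL.:* v) L.refl _ _ _ _)) _ ⟩
      coefficient (constant ((q ^ b) ^ n) L.* LL.∏ (λ j → local b (Fin.<-cmp a j)) J L.* dyson J′ L.* var a LL.^ n) (power a (+ n))
        ≈⟨ coefficient-lead (lead-* (lead-constant _) (lead-∏ J (λ {j} _ → local-lead b (Fin.<-cmp a j)))) (order-dyson-without J) n ⟩
      (q ^ b) ^ n * ∏ (λ j → localValue b (Fin.<-cmp a j)) J * CT J′
        ≈⟨ *-congʳ (*-congˡ (∏-localValue unique a∈J b)) ⟩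
      (q ^ b) ^ n * (κ⁻¹ (β a) b * (q ^ tail a J * (q ^ b) ^ ∥ J′ ∥)) * CT J′
        ≈⟨ solve 5 (λ x k t y z → x :* (k :* (t :* y)) :* z := t :* z :* (k :* (y :* x))) refl _ _ _ _ _ ⟩
      q ^ tail a J * CT J′ * (κ⁻¹ (β a) b * ((q ^ b) ^ ∥ J′ ∥ * (q ^ b) ^ n))
        ≈⟨ *-congˡ (*-congˡ (^-homo-* (q ^ b) ∥ J′ ∥ n)) ⟨
      q ^ tail a J * CT J′ * (κ⁻¹ (β a) b * (q ^ b) ^ M) ∎

  Sorted : List (Fin s) → Set
  Sorted = AllPairs Fin._<_

  sorted⇒unique : ∀ {J} → Sorted J → Unique J
  sorted⇒unique = AllPairs.map (λ i<j i≡j → Fin.<-irrefl i≡j i<j)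

  tail-head : ∀ {j J} → All (j Fin.<_) J → tail j (j ∷ J) ≡ ∥ J ∥
  tail-head {j} {J} j<J = ≡.cong₂ ℕ._+_ (later-same j)
    (Nat.fold-cong J (λ {i} i∈J → if-yes (j Fin.<? i) (All.lookup j<J i∈J)))

  tail-tail : ∀ {j a} J → j Fin.< a → tail a (j ∷ J) ≡ tail a J
  tail-tail {j} {a} J j<a = ≡.cong (ℕ._+ tail a J) (if-no (a Fin.<? j) (Fin.<-asym j<a))

  -- The summand at a is a difference of q-powers with exponents `tail a J` and `tail a J` + β_a. In
  -- a sorted list the second exponent is the tail of the entry before a, or the total weight for
  -- the first entry.
  tail-telescope : ∀ {J} → Sorted J → ∑ (λ a → q ^ tail a J * (1# - q ^ β a)) J ≈ 1# - q ^ ∥ J ∥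
  tail-telescope []                     = sym (-‿inverseʳ 1#)
  tail-telescope {j ∷ J} (j<J ∷ sorted) = begin
    q ^ tail j (j ∷ J) * (1# - q ^ β j) + ∑ (λ a → q ^ tail a (j ∷ J) * (1# - q ^ β a)) J
      ≈⟨ +-cong (*-congʳ (^-congʳ q (tail-head j<J)))
           (trans (Sum.fold-cong J (λ {a} a∈J → *-congʳ (^-congʳ q (tail-tail J (All.lookup j<J a∈J))))) (tail-telescope sorted)) ⟩
    q ^ ∥ J ∥ * (1# - q ^ β j) + (1# - q ^ ∥ J ∥)
      ≈⟨ solve 3 (λ x y z → x :* (con 1 :+ y) :+ (con 1 :+ z) := con 1 :+ x :* y :+ (x :+ z)) refl _ _ _ ⟩
    1# + q ^ ∥ J ∥ * - q ^ β j + (q ^ ∥ J ∥ - q ^ ∥ J ∥)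
      ≈⟨ trans (+-congˡ (-‿inverseʳ _)) (+-identityʳ _) ⟩
    1# + q ^ ∥ J ∥ * - q ^ β j
      ≈⟨ +-congˡ (trans (sym (-‿distribʳ-* _ _)) (-‿cong (trans (*-comm _ _) (sym (^-homo-* q (β j) ∥ J ∥))))) ⟩
    1# - q ^ (β j ℕ.+ ∥ J ∥) ∎

  expand : ∀ {J} → Unique J → ∀ {a} → a ∈ J → ∀ n k →
           coefficient (dyson J L.* LL.h (map node (keys J)) n) k ≈ ∑ (λ i → coefficient (summand J i n) k) J
  expand {J} unique {a} a∈J n k =
    trans (coefficient-cong (partialFractions unique (∈-keys⁺ a∈J (β>0 a)) n) k) (coefficient-∑ _ J k)

  ∥∥-without : ∀ {J a} → Unique J → a ∈ J → ∥ J ∥ ≡ β a ℕ.+ ∥ without a J ∥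
  ∥∥-without = Nat.fold-without Fin._≟_ β

  denominator : List (Fin s) → Carrier
  denominator = ∏ (λ i → ⟨ q ︔ q ⟩ β i)

  -- For n = 0 the series contributes h_0 = 1, so the constant term is the sum of those of the
  -- summands, and each of these leads to the constant term for `without a J`. Once denominators are
  -- cleared, all of them share (q;q)_{∥J∥-1}, and the rest telescopes to 1 - q^{∥J∥}. The bound m
  -- makes the recursion structural, as `without a J` is shorter than `J` but not a subterm of it.
  qDyson : ∀ m {J} → length J ≤ m → Sorted J → CT J * denominator J ≈ ⟨ q ︔ q ⟩ ∥ J ∥
  qDyson _ {[]} _ _ = trans (*-identityʳ _) coefficient-1
  qDyson (suc m) {J@(j ∷ J₀)} |J|≤ sorted = begin
    CT J * denominator J
      ≈⟨ *-congʳ (trans (coefficient-cong (L.sym (L.trans (L.*-congˡ (LL.h-zero (map node (keys J)))) (L.*-identityʳ _))) 𝟘)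
                        (expand unique (here ≡.refl) 0 𝟘)) ⟩
    ∑ (λ a → coefficient (summand J a 0) 𝟘) J * denominator J
      ≈⟨ trans (*-comm _ _) (∑-distribˡ _ _ J) ⟩
    ∑ (λ a → denominator J * coefficient (summand J a 0) 𝟘) J
      ≈⟨ Sum.fold-cong J term ⟩
    ∑ (λ a → ⟨ q ︔ q ⟩ (∥ J ∥ ∸ 1) * (q ^ tail a J * (1# - q ^ β a))) J
      ≈⟨ trans (sym (∑-distribˡ _ _ J)) (*-congˡ (tail-telescope sorted)) ⟩
    ⟨ q ︔ q ⟩ (∥ J ∥ ∸ 1) * (1# - q ^ ∥ J ∥)
      ≈⟨ last (ℕ.≤-trans (β>0 j) (ℕ.m≤m+n (β j) ∥ J₀ ∥)) ⟩
    ⟨ q ︔ q ⟩ ∥ J ∥ ∎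
    where
    unique : Unique J
    unique = sorted⇒unique sorted

    last : ∀ {N} → 1 ≤ N → ⟨ q ︔ q ⟩ (N ∸ 1) * (1# - q ^ N) ≈ ⟨ q ︔ q ⟩ N
    last {suc N} _ = *-congˡ (+-congˡ (-‿cong (*-comm _ _)))

    join : ∀ {B} → 1 ≤ B → ∀ N → ⟨ q ︔ q ⟩ N * ⟨ q ^ suc (N ℕ.+ 0) ︔ q ⟩ (B ∸ 1) ≈ ⟨ q ︔ q ⟩ (B ℕ.+ N ∸ 1)
    join {suc B} _ N = trans
      (*-congˡ (⟨⟩-cong (trans (^-congʳ q (≡.cong suc (ℕ.+-identityʳ N))) (*-comm _ _)) B))
      (sym (⟨⟩-+ q N B))

    term : ∀ {a} → a ∈ J → denominator J * coefficient (summand J a 0) 𝟘 ≈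
                           ⟨ q ︔ q ⟩ (∥ J ∥ ∸ 1) * (q ^ tail a J * (1# - q ^ β a))
    term {a} a∈J = begin
      denominator J * coefficient (summand J a 0) 𝟘
        ≈⟨ *-cong (Prod.fold-without Fin._≟_ _ unique a∈J) (reflexive (≡.cong (coefficient (summand J a 0)) (≡.sym (power-zero a)))) ⟩
      ⟨ q ︔ q ⟩ β a * denominator J′ * coefficient (summand J a 0) (power a (+ 0))
        ≈⟨ trans (xy∙z≈xz∙y _ _ _) (*-congʳ (coefficient-summand unique a∈J 0)) ⟩
      T * P * CT J′ * denominator J′
        ≈⟨ trans (*-assoc _ _ _) (*-congˡ (qDyson m (ℕ.s≤s⁻¹ (ℕ.≤-trans shorter |J|≤)) (AllPairs.filter⁺ (λ y → ¬? (y Fin.≟ a)) sorted))) ⟩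
      T * P * ⟨ q ︔ q ⟩ ∥ J′ ∥
        ≈⟨ solve 3 (λ t p x → t :* p :* x := x :* p :* t) refl _ _ _ ⟩
      ⟨ q ︔ q ⟩ ∥ J′ ∥ * P * T
        ≈⟨ *-congʳ (trans (join (β>0 a) ∥ J′ ∥) (reflexive (≡.cong (λ N → ⟨ q ︔ q ⟩ (N ∸ 1)) (≡.sym (∥∥-without unique a∈J))))) ⟩
      ⟨ q ︔ q ⟩ (∥ J ∥ ∸ 1) * T ∎
      where
      J′ : List (Fin s)
      J′ = without a J
      T P : Carrier
      T = q ^ tail a J * (1# - q ^ β a)
      P = ⟨ q ^ suc (∥ J′ ∥ ℕ.+ 0) ︔ q ⟩ (β a ∸ 1)
      shorter : length J′ < length J
      shorter = List.filter-notAll (λ y → ¬? (y Fin.≟ a)) J (lose a∈J (λ a≢a → a≢a ≡.refl))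

  coefficient-vanishes : ∀ {J} → Unique J → ∀ {a} → a ∈ J → ∀ n k → (∀ i → lookup k i ℤ.< + n) →
                         coefficient (dyson J L.* LL.h (map node (keys J)) n) k ≈ 0#
  coefficient-vanishes {J} unique a∈J n k k<n = trans (expand unique a∈J n k)
    (trans (Sum.fold-cong J (λ {i} _ → order-vanish (order-summand J i n) k (k<n i))) (Sum.fold-ε J))

  coefficient-power : ∀ {J} → Sorted J → ∀ {a} → a ∈ J → ∀ {n} → 1 ≤ n →
    coefficient (dyson J L.* LL.h (map node (keys J)) n) (power a (+ n)) * denominator J ≈
    q ^ tail a J * ((1# - q ^ β a) * ⟨ q ︔ q ⟩ (∥ J ∥ ∸ β a)) * ⟨ q ^ (∥ J ∥ ∸ β a ℕ.+ n ℕ.+ 1) ︔ q ⟩ (β a ∸ 1)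
  coefficient-power {J} sorted {a} a∈J {n} 1≤n = begin
    coefficient (dyson J L.* LL.h (map node (keys J)) n) (power a (+ n)) * denominator J
      ≈⟨ *-cong (trans (expand unique a∈J n _) (trans (Sum.fold-without Fin._≟_ _ unique a∈J)
           (trans (+-congˡ (trans (Sum.fold-cong J′ others) (Sum.fold-ε J′))) (+-identityʳ _))))
           (Prod.fold-without Fin._≟_ _ unique a∈J) ⟩
    coefficient (summand J a n) (power a (+ n)) * (⟨ q ︔ q ⟩ β a * denominator J′)
      ≈⟨ solve 3 (λ x y z → x :* (y :* z) := y :* x :* z) refl _ _ _ ⟩
    ⟨ q ︔ q ⟩ β a * coefficient (summand J a n) (power a (+ n)) * denominator J′
      ≈⟨ *-congʳ (coefficient-summand unique a∈J n) ⟩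
    q ^ tail a J * (1# - q ^ β a) * ⟨ q ^ suc (∥ J′ ∥ ℕ.+ n) ︔ q ⟩ (β a ∸ 1) * CT J′ * denominator J′
      ≈⟨ trans (*-assoc _ _ _) (*-congˡ (qDyson (length J′) ℕ.≤-refl (AllPairs.filter⁺ (λ y → ¬? (y Fin.≟ a)) sorted))) ⟩
    q ^ tail a J * (1# - q ^ β a) * ⟨ q ^ suc (∥ J′ ∥ ℕ.+ n) ︔ q ⟩ (β a ∸ 1) * ⟨ q ︔ q ⟩ ∥ J′ ∥
      ≈⟨ solve 4 (λ x y z w → x :* y :* z :* w := x :* (y :* w) :* z) refl _ _ _ _ ⟩
    q ^ tail a J * ((1# - q ^ β a) * ⟨ q ︔ q ⟩ ∥ J′ ∥) * ⟨ q ^ suc (∥ J′ ∥ ℕ.+ n) ︔ q ⟩ (β a ∸ 1)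
      ≡⟨ ≡.cong₂ (λ N M → q ^ tail a J * ((1# - q ^ β a) * ⟨ q ︔ q ⟩ N) * ⟨ q ^ M ︔ q ⟩ (β a ∸ 1))
           ∥J′∥≡ (≡.trans (ℕ.+-comm 1 _) (≡.cong (λ N → N ℕ.+ n ℕ.+ 1) ∥J′∥≡)) ⟩
    q ^ tail a J * ((1# - q ^ β a) * ⟨ q ︔ q ⟩ (∥ J ∥ ∸ β a)) * ⟨ q ^ (∥ J ∥ ∸ β a ℕ.+ n ℕ.+ 1) ︔ q ⟩ (β a ∸ 1) ∎
    where
    unique : Unique J
    unique = sorted⇒unique sorted
    J′ : List (Fin s)
    J′ = without a J
    -- This is where n ≥ 1 matters: z_i has exponent 0 < n in z_a^n, so only the summand of a
    -- contributes, whereas for n = 0 all of them do.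
    others : ∀ {i} → i ∈ J′ → coefficient (summand J i n) (power a (+ n)) ≈ 0#
    others {i} i∈J′ = order-vanish (order-summand J i n) (power a (+ n))
      (≡.subst (ℤ._< + n) (≡.sym (lookup-power-other (∈-without⁻ {J = J} i∈J′ ∘ ≡.sym) (+ n))) (ℤ.+<+ 1≤n))
    ∥J′∥≡ : ∥ J′ ∥ ≡ ∥ J ∥ ∸ β a
    ∥J′∥≡ = ≡.trans (≡.sym (ℕ.m+n∸m≡n (β a) ∥ J′ ∥)) (≡.cong (_∸ β a) (≡.sym (∥∥-without unique a∈J)))

-- Power series in 1/w₁: the inverse factor generates `h`.

module SeriesProduct {c ℓ} (A : CommutativeRing c ℓ) where
  open CommutativeRing A hiding (zero)
  open RingLemmas A
  open Algebra.Properties.CommutativeMonoid.Sum +-commutativeMonoid using (sum; sum-cong-≋; sum-replicate-zero; ∑-distrib-+)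
  open Algebra.Properties.Semiring.Sum semiring using (*-distribˡ-sum)
  private
    module P = RawRing (powerSeries rawRing)
    module PS = Algebra.Definitions.RawSemiring P.rawSemiring

  *-cong-series : ∀ {f f′ g g′} → f P.≈ f′ → g P.≈ g′ → f P.* g P.≈ f′ P.* g′
  *-cong-series f≈f′ g≈g′ n = sum-cong-≋ {suc n} (λ i → *-cong (f≈f′ (toℕ i)) (g≈g′ (n ∸ toℕ i)))

  constant-series-* : ∀ {f x} → f 0 ≈ x → (∀ n → f (suc n) ≈ 0#) → ∀ g n → (f P.* g) n ≈ x * g n
  constant-series-* f0≈x f+≈0 g n = trans
    (+-cong (*-congʳ f0≈x) (trans
      (sum-cong-≋ {n} (λ i → trans (*-congʳ (f+≈0 (toℕ i))) (zeroˡ _))) (sum-replicate-zero n)))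
    (+-identityʳ _)

  geometricStep-* : ∀ u f g → geometricStep u f P.* g P.≈ geometricStep u (f P.* g)
  geometricStep-* u f g zero    = refl
  geometricStep-* u f g (suc n) = begin
    f 0 * g (suc n) + sum {suc n} (λ i → (f (suc (toℕ i)) + u * S (toℕ i)) * g (n ∸ toℕ i))
      ≈⟨ +-congˡ (sum-cong-≋ {suc n} {y = λ i → t₁ i + t₂ i} (λ i → trans (distribʳ (g (n ∸ toℕ i)) _ _) (+-congˡ (*-assoc u (S (toℕ i)) _)))) ⟩
    f 0 * g (suc n) + sum {suc n} (λ i → t₁ i + t₂ i)
      ≈⟨ +-congˡ (∑-distrib-+ t₁ t₂) ⟩
    f 0 * g (suc n) + (sum t₁ + sum t₂)
      ≈⟨ trans (sym (+-assoc _ _ _)) (+-congˡ (sym (*-distribˡ-sum {suc n} u (λ i → S (toℕ i) * g (n ∸ toℕ i))))) ⟩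
    (f P.* g) (suc n) + u * (S P.* g) n
      ≈⟨ +-congˡ (*-congˡ (geometricStep-* u f g n)) ⟩
    (f P.* g) (suc n) + u * geometricStep u (f P.* g) n ∎
    where
    S : ℕ → Carrier
    S = geometricStep u f
    t₁ t₂ : Fin (suc n) → Carrier
    t₁ i = f (suc (toℕ i)) * g (n ∸ toℕ i)
    t₂ i = u * (S (toℕ i) * g (n ∸ toℕ i))

  geometric-* : ∀ u g → (u ^_) P.* g P.≈ geometricStep u g
  geometric-* u g n = trans (*-cong-series {u ^_} {geometricStep u one} {g} {g} powers (λ _ → refl) n)
    (trans (geometricStep-* u one g n)
           (geometricStep-cong refl (λ m → trans (constant-series-* {one} refl (λ _ → refl) g m) (*-identityˡ _)) n))
    where
    powers : ∀ n → u ^ n ≈ geometricStep u one n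
    powers zero    = refl
    powers (suc n) = trans (*-congˡ (powers n)) (sym (+-identityˡ _))

  -- The trailing factor `g` will be the product over the remaining variables, so that the double
  -- product becomes a single fold over the concatenated nodes.
  product-geometric-* : ∀ m (f : ℕ → Carrier) g →
    PS.product {m} (λ b → f (toℕ b) ^_) P.* g P.≈ foldr geometricStep g (applyUpTo f m)
  product-geometric-* zero    f g n = trans (constant-series-* {P.1#} refl (λ _ → refl) g n) (*-identityˡ _)
  product-geometric-* (suc m) f g n = begin
    (((f 0 ^_) P.* rest) P.* g) n
      ≈⟨ *-cong-series {g = g} (geometric-* (f 0) rest) (λ _ → refl) n ⟩
    (geometricStep (f 0) rest P.* g) n
      ≈⟨ geometricStep-* (f 0) rest g n ⟩
    geometricStep (f 0) (rest P.* g) n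
      ≈⟨ geometricStep-cong refl (product-geometric-* m (f ∘ suc) g) n ⟩
    geometricStep (f 0) (foldr geometricStep g (applyUpTo (f ∘ suc) m)) n ∎
    where
    rest : ℕ → Carrier
    rest = PS.product {m} (λ b → f (suc (toℕ b)) ^_)

  product-product-geometric : ∀ {X : Set} {m} (t : Fin m → X) (β : X → ℕ) (f : X → ℕ → Carrier) →
    PS.product (λ i → PS.product {β (t i)} (λ b → f (t i) (toℕ b) ^_)) P.≈
    h (concatMap (λ j → map (f j) (upTo (β j))) (tabulate t))
  product-product-geometric {m = zero}  t β f zero    = refl
  product-product-geometric {m = zero}  t β f (suc n) = refl
  product-product-geometric {m = suc m} t β f n = begin
    (PS.product {β (t zero)} (λ b → f (t zero) (toℕ b) ^_) P.* rest) n
      ≈⟨ product-geometric-* (β (t zero)) (f (t zero)) rest n ⟩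
    foldr geometricStep rest (applyUpTo (f (t zero)) (β (t zero))) n
      ≈⟨ foldr-cong (applyUpTo (f (t zero)) (β (t zero))) (product-product-geometric (t ∘ suc) β f) n ⟩
    foldr geometricStep (h tail) (applyUpTo (f (t zero)) (β (t zero))) n
      ≡⟨ ≡.cong (λ l → foldr geometricStep (h tail) l n) (List.map-upTo (f (t zero)) (β (t zero))) ⟨
    foldr geometricStep (h tail) (map (f (t zero)) (upTo (β (t zero)))) n
      ≡⟨ ≡.cong (λ s → s n) (List.foldr-++ geometricStep one (map (f (t zero)) (upTo (β (t zero)))) tail) ⟨
    h (map (f (t zero)) (upTo (β (t zero))) ++ tail) n ∎
    where
    rest : ℕ → Carrier
    rest = PS.product (λ i → PS.product {β (t (suc i))} (λ b → f (t (suc i)) (toℕ b) ^_))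
    tail : List Carrier
    tail = concatMap (λ j → map (f j) (upTo (β j))) (tabulate (t ∘ suc))
    foldr-cong : ∀ us {g g′} → g P.≈ g′ → foldr geometricStep g us P.≈ foldr geometricStep g′ us
    foldr-cong []       g≈g′ = g≈g′
    foldr-cong (u ∷ us) g≈g′ = geometricStep-cong refl (foldr-cong us g≈g′)

-- The theorem for generic q.

module GenericCase {c ℓ} (R : CommutativeRing c ℓ) {q : CommutativeRing.Carrier R} (generic : IsGeneric R q)
  {s : ℕ} (β : Fin s → ℕ) (β>0 : ∀ i → 1 ≤ β i) where
  open CommutativeRing R using (trans; reflexive; *-cong)
  open RingNotation R
  open Laurent R s
  open LaurentRing R s using (laurentRing)
  open LaurentModel R s using (laurentAlgebra)
  open Expansion R q s β
  open Weights β
  open DysonProduct laurentAlgebra q β hiding (factor)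
  open CoefficientFormula laurentAlgebra generic β β>0 hiding (denominator)
  private
    module D = DysonProduct laurentAlgebra q β
    module L = CommutativeRing laurentRing
    module LL = RingLemmas laurentRing
    module RL = RingLemmas R
    module S = SeriesProduct laurentRing
    module LSum = Algebra.Properties.CommutativeMonoid.Sum L.*-commutativeMonoid
    module Nat = ListFold ℕ.+-0-commutativeMonoid

  J : List (Fin s)
  J = allFin s

  laurentFactor≈dyson : laurentFactor L.≈ dyson J
  laurentFactor≈dyson = L.trans {laurentFactor} {LSum.sum (λ i → LL.∏ (D.factor i) J)} {dyson J}
    (LSum.sum-cong-≋ (λ i → LL.Prod.fold-tabulate (D.factor i) id))
    (LL.Prod.fold-tabulate (λ i → LL.∏ (D.factor i) J) id)

  inverseFactor≈h : ∀ n → inverseFactor n L.≈ LL.h (map node (keys J)) n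
  inverseFactor≈h n = L.trans {inverseFactor n} {LL.h (concatMap (λ j → map (λ b → node (j , b)) (upTo (β j))) J) n} {LL.h (map node (keys J)) n}
    (S.product-product-geometric id β (λ j b → node (j , b)) n)
    (L.reflexive (≡.cong (λ us → LL.h us n) (≡.sym (≡.trans
      (List.map-concatMap node (λ j → map (j ,_) (upTo (β j))) J)
      (List.concatMap-cong (λ j → ≡.sym (List.map-∘ (upTo (β j)))) J)))))

  F≈ : ∀ n → F n L.≈ dyson J L.* LL.h (map node (keys J)) n
  F≈ n = L.trans {F n} {laurentFactor L.* inverseFactor n} {dyson J L.* LL.h (map node (keys J)) n}
    (S.constant-series-* {embed laurentFactor} {laurentFactor} (L.refl {laurentFactor}) (λ _ → L.refl {[]}) inverseFactor n)
    (L.*-cong {laurentFactor} {dyson J} {inverseFactor n} {LL.h (map node (keys J)) n} laurentFactor≈dyson (inverseFactor≈h n))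

  F-vanishes : ∀ {n} → Fin s → ∀ k → (∀ i → lookup k i ℤ.< + n) → [z^ k /w^ n ]F ≈ 0#
  F-vanishes {n} a k k<n = trans (F≈ n k)
    (coefficient-vanishes (sorted⇒unique sorted) (∈-allFin a) n k k<n)
    where
    sorted : Sorted J
    sorted = AllPairs.tabulate⁺-< id

  F-power : ∀ {n} → 1 ≤ n → ∀ a →
    [z^ power a (+ n) /w^ n ]F * product (λ i → ⟨ q ︔ q ⟩ β i) ≈
    q ^ tailSum a * ((1# - q ^ β a) * (⟨ q ︔ q ⟩ (∣β∣ ∸ β a))) * (⟨ q ^ (∣β∣ ∸ β a ℕ.+ n ℕ.+ 1) ︔ q ⟩ (β a ∸ 1))
  F-power {n} 1≤n a = trans
    (*-cong (F≈ n (power a (+ n))) (RL.Prod.fold-tabulate (λ i → ⟨ q ︔ q ⟩ β i) id))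
    (trans (coefficient-power (AllPairs.tabulate⁺-< id) (∈-allFin a) 1≤n)
           (reflexive (≡.cong₂ (λ t N → q ^ t * ((1# - q ^ β a) * (⟨ q ︔ q ⟩ (N ∸ β a))) * (⟨ q ^ (N ∸ β a ℕ.+ n ℕ.+ 1) ︔ q ⟩ (β a ∸ 1)))
              (≡.sym (Nat.fold-tabulate (later a) id)) (≡.sym (Nat.fold-tabulate β id)))))

-- Transfer between rings by a logical relation.

record RingRelation {c₁ ℓ₁ c₂ ℓ₂ r} (A : RawRing c₁ ℓ₁) (B : RawRing c₂ ℓ₂)
  (_~_ : RawRing.Carrier A → RawRing.Carrier B → Set r) : Set (c₁ ⊔ c₂ ⊔ r) where
  private
    module A = RawRing A
    module B = RawRing B
  field
    0~ : A.0# ~ B.0#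
    1~ : A.1# ~ B.1#
    +~ : ∀ {x y x′ y′} → x ~ x′ → y ~ y′ → (x A.+ y) ~ (x′ B.+ y′)
    *~ : ∀ {x y x′ y′} → x ~ x′ → y ~ y′ → (x A.* y) ~ (x′ B.* y′)
    -~ : ∀ {x x′} → x ~ x′ → (A.- x) ~ (B.- x′)

module Parametricity {c₁ ℓ₁ c₂ ℓ₂ r} (A : RawRing c₁ ℓ₁) (B : RawRing c₂ ℓ₂)
  {_~_ : RawRing.Carrier A → RawRing.Carrier B → Set r} (rel : RingRelation A B _~_) where
  open RingRelation rel
  private
    module A = RawRing A
    module B = RawRing B
    module A^ = Algebra.Definitions.RawSemiring A.rawSemiring
    module B^ = Algebra.Definitions.RawSemiring B.rawSemiring
    module AQ = QPochhammer A
    module BQ = QPochhammer B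

  ^~ : ∀ {x x′} → x ~ x′ → ∀ n → (x A^.^ n) ~ (x′ B^.^ n)
  ^~ x~x′ zero    = 1~
  ^~ x~x′ (suc n) = *~ x~x′ (^~ x~x′ n)

  sum~ : ∀ {n} {f : Fin n → A.Carrier} {f′ : Fin n → B.Carrier} → (∀ i → f i ~ f′ i) → A^.sum f ~ B^.sum f′
  sum~ {zero}  f~f′ = 0~
  sum~ {suc n} f~f′ = +~ (f~f′ zero) (sum~ (f~f′ ∘ suc))

  product~ : ∀ {n} {f : Fin n → A.Carrier} {f′ : Fin n → B.Carrier} → (∀ i → f i ~ f′ i) → A^.product f ~ B^.product f′
  product~ {zero}  f~f′ = 1~
  product~ {suc n} f~f′ = *~ (f~f′ zero) (product~ (f~f′ ∘ suc))

  ⟨⟩~ : ∀ {z z′ q q′} → z ~ z′ → q ~ q′ → ∀ n → (AQ.⟨ z ︔ q ⟩ n) ~ (BQ.⟨ z′ ︔ q′ ⟩ n)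
  ⟨⟩~ z~z′ q~q′ zero    = 1~
  ⟨⟩~ z~z′ q~q′ (suc n) = *~ (⟨⟩~ z~z′ q~q′ n) (+~ 1~ (-~ (*~ (^~ q~q′ n) z~z′)))

  if~ : ∀ (b : Bool) {x y x′ y′} → x ~ x′ → y ~ y′ → (if b then x else y) ~ (if b then x′ else y′)
  if~ true  x~x′ y~y′ = x~x′
  if~ false x~x′ y~y′ = y~y′

  series~ : RingRelation (powerSeries A) (powerSeries B) (λ f f′ → ∀ n → f n ~ f′ n)
  series~ = record
    { 0~ = λ _ → 0~
    ; 1~ = λ { zero → 1~ ; (suc _) → 0~ }
    ; +~ = λ f~f′ g~g′ n → +~ (f~f′ n) (g~g′ n)
    ; *~ = λ f~f′ g~g′ n → sum~ {suc n} (λ i → *~ (f~f′ (toℕ i)) (g~g′ (n ∸ toℕ i)))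
    ; -~ = λ f~f′ n → -~ (f~f′ n)
    }

module Transfer {c₁ ℓ₁ c₂ ℓ₂ r} (A : CommutativeRing c₁ ℓ₁) (B : CommutativeRing c₂ ℓ₂)
  {_~_ : CommutativeRing.Carrier A → CommutativeRing.Carrier B → Set r}
  (rel : RingRelation (CommutativeRing.rawRing A) (CommutativeRing.rawRing B) _~_) (s : ℕ) where
  open RingRelation rel
  private
    module A = CommutativeRing A
    module B = CommutativeRing B
    module AL = Laurent A s
    module BL = Laurent B s
    module Base = Parametricity A.rawRing B.rawRing rel

  _~ᵗ_ : AL.Term → BL.Term → Set r
  (x , e) ~ᵗ (x′ , e′) = x ~ x′ × e ≡ e′

  -- Related lists carry equal exponents position by position. The same construction over the two
  -- rings yields such lists, because every choice made in it depends on indices and exponents and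
  -- never on ring elements.
  _~ᴸ_ : List AL.Term → List BL.Term → Set _
  _~ᴸ_ = Pointwise _~ᵗ_

  laurent~ : RingRelation AL.laurent BL.laurent _~ᴸ_
  laurent~ = record
    { 0~ = []
    ; 1~ = (1~ , ≡.refl) ∷ []
    ; +~ = Pointwise.++⁺
    ; *~ = times
    ; -~ = λ p~p′ → Pointwise.map⁺ _ _ (Pointwise.map (λ { (x~x′ , e≡e′) → -~ x~x′ , e≡e′ }) p~p′)
    }
    where
    times : ∀ {p w p′ w′} → p ~ᴸ p′ → w ~ᴸ w′ → RawRing._*_ AL.laurent p w ~ᴸ RawRing._*_ BL.laurent p′ w′
    times []                    w~w′ = []
    times ((x~x′ , ≡.refl) ∷ p~p′) w~w′ = Pointwise.++⁺
      (Pointwise.map⁺ _ _ (Pointwise.map (λ { (y~y′ , ≡.refl) → *~ x~x′ y~y′ , ≡.refl }) w~w′))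
      (times p~p′ w~w′)

  coefficient~ : ∀ {p p′} → p ~ᴸ p′ → ∀ k → AL.coefficient p k ~ BL.coefficient p′ k
  coefficient~ []                       k = 0~
  coefficient~ {(_ , e) ∷ _} ((x~x′ , ≡.refl) ∷ p~p′) k =
    +~ (Base.if~ (does (Vec.≡-dec ℤ._≟_ e k)) x~x′ 0~) (coefficient~ p~p′ k)

  module _ {q q′} (q~q′ : q ~ q′) (β : Fin s → ℕ) where
    private
      module AE = Expansion A q s β
      module BE = Expansion B q′ s β
      module Lau = Parametricity AL.laurent BL.laurent laurent~
      module Ser = Parametricity AE.series BE.series Lau.series~
      module L = RingRelation laurent~
      module S = RingRelation Lau.series~

    constant~ : ∀ {x x′} → x ~ x′ → AL.constant x ~ᴸ BL.constant x′
    constant~ x~x′ = (x~x′ , ≡.refl) ∷ []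

    var~ : ∀ i → AL.var i ~ᴸ BL.var i
    var~ i = (1~ , ≡.refl) ∷ []

    var⁻¹~ : ∀ i → AL.var⁻¹ i ~ᴸ BL.var⁻¹ i
    var⁻¹~ i = (1~ , ≡.refl) ∷ []

    laurentFactor~ : AE.laurentFactor ~ᴸ BE.laurentFactor
    laurentFactor~ = Lau.product~ λ i → Lau.product~ λ j → Lau.if~ (does (i Fin.<? j))
      (L.*~ (Lau.⟨⟩~ (L.*~ (var~ i) (var⁻¹~ j)) (constant~ q~q′) (β i))
            (Lau.⟨⟩~ (L.*~ (constant~ q~q′) (L.*~ (var~ j) (var⁻¹~ i))) (constant~ q~q′) (β j)))
      L.1~

    inverseFactor~ : ∀ n → AE.inverseFactor n ~ᴸ BE.inverseFactor n
    inverseFactor~ = Ser.product~ λ i → Ser.product~ {β i} λ b n →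
      Lau.^~ (L.*~ (Lau.^~ (constant~ q~q′) (toℕ b)) (var~ i)) n

    embed~ : ∀ {p p′} → p ~ᴸ p′ → ∀ n → AE.embed p n ~ᴸ BE.embed p′ n
    embed~ p~p′ zero    = p~p′
    embed~ p~p′ (suc n) = []

    F~ : ∀ k n → AE.[z^ k /w^ n ]F ~ BE.[z^ k /w^ n ]F
    F~ k n = coefficient~ (S.*~ (embed~ laurentFactor~) inverseFactor~ n) k

    private
      module AN = RingNotation A
      module BN = RingNotation B
      open Weights β

    F*denominator~ : ∀ k n →
      (AE.[z^ k /w^ n ]F A.* AN.product (λ i → AN.⟨ q ︔ q ⟩ β i)) ~
      (BE.[z^ k /w^ n ]F B.* BN.product (λ i → BN.⟨ q′ ︔ q′ ⟩ β i))
    F*denominator~ k n = *~ (F~ k n) (Base.product~ λ i → Base.⟨⟩~ q~q′ q~q′ (β i))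

    numerator~ : ∀ a m →
      (q AN.^ tailSum a A.* ((A.1# A.- q AN.^ β a) A.* (AN.⟨ q ︔ q ⟩ (∣β∣ ∸ β a))) A.* (AN.⟨ q AN.^ m ︔ q ⟩ (β a ∸ 1))) ~
      (q′ BN.^ tailSum a B.* ((B.1# B.- q′ BN.^ β a) B.* (BN.⟨ q′ ︔ q′ ⟩ (∣β∣ ∸ β a))) B.* (BN.⟨ q′ BN.^ m ︔ q′ ⟩ (β a ∸ 1)))
    numerator~ a m = *~
      (*~ (Base.^~ q~q′ (tailSum a)) (*~ (+~ 1~ (-~ (Base.^~ q~q′ (β a)))) (Base.⟨⟩~ q~q′ q~q′ (∣β∣ ∸ β a))))
      (Base.⟨⟩~ (Base.^~ q~q′ m) q~q′ (β a ∸ 1))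

-- Integer polynomials in q and their values.

Polynomial : Set
Polynomial = List ℕ

infixl 6 _⊞_
infixl 7 _⊠_

_⊞_ : Polynomial → Polynomial → Polynomial
[]      ⊞ p       = p
(a ∷ p) ⊞ []      = a ∷ p
(a ∷ p) ⊞ (b ∷ w) = (a ℕ.+ b) ∷ (p ⊞ w)

_⊠_ : Polynomial → Polynomial → Polynomial
[]      ⊠ w = []
(a ∷ p) ⊠ w = map (a ℕ.*_) w ⊞ (0 ∷ p ⊠ w)

-- Once m exceeds all coefficients, they are the digits of the value in base m and are determined by
-- it. For this reason they are natural numbers, and signs are carried by pairs of polynomials.
evalℕ : ℕ → Polynomial → ℕ
evalℕ m []      = 0
evalℕ m (a ∷ p) = a ℕ.+ m ℕ.* evalℕ m p

module Evaluation {c ℓ} (A : CommutativeRing c ℓ) (x : CommutativeRing.Carrier A) where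
  open CommutativeRing A hiding (zero)
  open RingLemmas A
  open Algebra.Properties.Semiring.Mult semiring public renaming (_×_ to _·_) using (×-homo-+; ×1-homo-*)

  eval : Polynomial → Carrier
  eval []      = 0#
  eval (a ∷ p) = a · 1# + x * eval p

  eval-⊞ : ∀ p w → eval (p ⊞ w) ≈ eval p + eval w
  eval-⊞ []      w       = sym (+-identityˡ _)
  eval-⊞ (a ∷ p) []      = sym (+-identityʳ _)
  eval-⊞ (a ∷ p) (b ∷ w) = begin
    (a ℕ.+ b) · 1# + x * eval (p ⊞ w)
      ≈⟨ +-cong (×-homo-+ 1# a b) (*-congˡ (eval-⊞ p w)) ⟩
    a · 1# + b · 1# + x * (eval p + eval w)
      ≈⟨ solve 5 (λ a b x p w → a :+ b :+ x :* (p :+ w) := (a :+ x :* p) :+ (b :+ x :* w)) refl _ _ _ _ _ ⟩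
    a · 1# + x * eval p + (b · 1# + x * eval w) ∎

  eval-scale : ∀ a w → eval (map (a ℕ.*_) w) ≈ a · 1# * eval w
  eval-scale a []      = sym (zeroʳ _)
  eval-scale a (b ∷ w) = begin
    (a ℕ.* b) · 1# + x * eval (map (a ℕ.*_) w)
      ≈⟨ +-cong (×1-homo-* a b) (*-congˡ (eval-scale a w)) ⟩
    a · 1# * (b · 1#) + x * (a · 1# * eval w)
      ≈⟨ solve 4 (λ a b x w → a :* b :+ x :* (a :* w) := a :* (b :+ x :* w)) refl _ _ _ _ ⟩
    a · 1# * (b · 1# + x * eval w) ∎

  eval-⊠ : ∀ p w → eval (p ⊠ w) ≈ eval p * eval w
  eval-⊠ []      w = sym (zeroˡ _)
  eval-⊠ (a ∷ p) w = begin
    eval (map (a ℕ.*_) w ⊞ (0 ∷ p ⊠ w))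
      ≈⟨ eval-⊞ (map (a ℕ.*_) w) (0 ∷ p ⊠ w) ⟩
    eval (map (a ℕ.*_) w) + (0# + x * eval (p ⊠ w))
      ≈⟨ +-cong (eval-scale a w) (+-congˡ (*-congˡ (eval-⊠ p w))) ⟩
    a · 1# * eval w + (0# + x * (eval p * eval w))
      ≈⟨ solve 4 (λ a w x p → a :* w :+ (con 0 :+ x :* (p :* w)) := (a :+ x :* p) :* w) refl _ _ _ _ ⟩
    (a · 1# + x * eval p) * eval w ∎

  -- y is the value at x of the integer polynomial p - w.
  record Represents (pw : Polynomial × Polynomial) (y : Carrier) : Set ℓ where
    constructor represents
    field
      equation : y + eval (proj₂ pw) ≈ eval (proj₁ pw)

  represents-+ : ∀ {p w p′ w′ y y′} → Represents (p , w) y → Represents (p′ , w′) y′ →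
                 Represents (p ⊞ p′ , w ⊞ w′) (y + y′)
  represents-+ {p} {w} {p′} {w′} {y} {y′} (represents eq) (represents eq′) = represents (begin
    y + y′ + eval (w ⊞ w′)           ≈⟨ +-congˡ (eval-⊞ w w′) ⟩
    y + y′ + (eval w + eval w′)      ≈⟨ solve 4 (λ a b k d → a :+ b :+ (k :+ d) := a :+ k :+ (b :+ d)) refl _ _ _ _ ⟩
    y + eval w + (y′ + eval w′)      ≈⟨ +-cong eq eq′ ⟩
    eval p + eval p′                 ≈⟨ eval-⊞ p p′ ⟨
    eval (p ⊞ p′)                    ∎)

  represents-* : ∀ {p w p′ w′ y y′} → Represents (p , w) y → Represents (p′ , w′) y′ →
                 Represents (p ⊠ p′ ⊞ w ⊠ w′ , p ⊠ w′ ⊞ w ⊠ p′) (y * y′)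
  represents-* {p} {w} {p′} {w′} {y} {y′} (represents eq) (represents eq′) = represents (begin
    y * y′ + eval (p ⊠ w′ ⊞ w ⊠ p′)
      ≈⟨ +-congˡ (trans (eval-⊞ (p ⊠ w′) (w ⊠ p′)) (+-cong (eval-⊠ p w′) (eval-⊠ w p′))) ⟩
    y * y′ + (eval p * eval w′ + eval w * eval p′)
      ≈⟨ +-congˡ (+-cong (*-congʳ (sym eq)) (*-congˡ (sym eq′))) ⟩
    y * y′ + ((y + eval w) * eval w′ + eval w * (y′ + eval w′))
      ≈⟨ solve 4 (λ y y′ w w′ → y :* y′ :+ ((y :+ w) :* w′ :+ w :* (y′ :+ w′)) := (y :+ w) :* (y′ :+ w′) :+ w :* w′) refl _ _ _ _ ⟩
    (y + eval w) * (y′ + eval w′) + eval w * eval w′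
      ≈⟨ +-congʳ (*-cong eq eq′) ⟩
    eval p * eval p′ + eval w * eval w′
      ≈⟨ trans (eval-⊞ (p ⊠ p′) (w ⊠ w′)) (+-cong (eval-⊠ p p′) (eval-⊠ w w′)) ⟨
    eval (p ⊠ p′ ⊞ w ⊠ w′) ∎)

  represents-neg : ∀ {p w y} → Represents (p , w) y → Represents (w , p) (- y)
  represents-neg {p} {w} {y} (represents eq) = represents (begin
    - y + eval p          ≈⟨ +-congˡ eq ⟨
    - y + (y + eval w)    ≈⟨ +-assoc _ _ _ ⟨
    - y + y + eval w      ≈⟨ trans (+-congʳ (-‿inverseˡ y)) (+-identityˡ _) ⟩
    eval w                ∎)

  represents-0 : Represents ([] , []) 0#
  represents-0 = represents (+-identityʳ 0#)

  represents-1 : Represents (1 ∷ [] , []) 1#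
  represents-1 = represents (sym (trans (+-congˡ (zeroʳ x)) (+-identityʳ _)))

  represents-x : Represents (0 ∷ 1 ∷ [] , []) x
  represents-x = represents (begin
    x + 0#                             ≈⟨ solve 1 (λ x → x :+ con 0 := con 0 :+ x :* (con 1 :+ con 0 :+ x :* con 0)) refl x ⟩
    0# + x * (1# + 0# + x * 0#)        ∎)

module _ where
  private
    cancel : ∀ {m} a b x y → a < m → b < m → a ℕ.+ m ℕ.* x ≡ b ℕ.+ m ℕ.* y → a ≡ b
    cancel {suc m} a b x y a<m b<m eq = ≡.trans (≡.sym (digit a x a<m)) (≡.trans (≡.cong (_% suc m) eq) (digit b y b<m))
      where
      digit : ∀ a x → a < suc m → (a ℕ.+ suc m ℕ.* x) % suc m ≡ a
      digit a x a<m = ≡.trans (≡.cong (λ t → (a ℕ.+ t) % suc m) (ℕ.*-comm (suc m) x))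
        (≡.trans (ℕ.[m+kn]%n≡m%n a x (suc m)) (ℕ.m<n⇒m%n≡m a<m))

  evalℕ-head : ∀ M a b p w → (∀ m → M ≤ m → a ℕ.+ m ℕ.* evalℕ m p ≡ b ℕ.+ m ℕ.* evalℕ m w) → a ≡ b
  evalℕ-head M a b p w eq = cancel {m} a b (evalℕ m p) (evalℕ m w)
    (s≤s (ℕ.≤-trans (ℕ.m≤n+m a M) (ℕ.m≤m+n _ b)))
    (s≤s (ℕ.m≤n+m b _))
    (eq m (ℕ.m≤n⇒m≤1+n (ℕ.≤-trans (ℕ.m≤m+n M a) (ℕ.m≤m+n _ b))))
    where
    m : ℕ
    -- At least M, and larger than both a and b, which are therefore the last digits of the two
    -- values in base m.
    m = suc (M ℕ.+ a ℕ.+ b)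

  -- Once the constant coefficients are known to agree, a factor m is cancelled. It must be nonzero,
  -- and the raised bound ensures this.
  evalℕ-tail : ∀ M a b p w → (∀ m → M ≤ m → a ℕ.+ m ℕ.* evalℕ m p ≡ b ℕ.+ m ℕ.* evalℕ m w) →
               ∀ m → suc M ≤ m → evalℕ m p ≡ evalℕ m w
  evalℕ-tail M a b p w eq (suc m) (s≤s M≤m) = ℕ.*-cancelˡ-≡ _ _ (suc m)
    (ℕ.+-cancelˡ-≡ a _ _ (≡.trans (eq (suc m) (ℕ.m≤n⇒m≤1+n M≤m))
      (≡.cong (ℕ._+ suc m ℕ.* evalℕ (suc m) w) (≡.sym (evalℕ-head M a b p w eq)))))

module _ {c ℓ} (A : CommutativeRing c ℓ) (x : CommutativeRing.Carrier A) where
  open CommutativeRing A hiding (zero)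
  open Evaluation A x

  -- The coefficients agree one by one from the lowest. The lists may still differ in trailing
  -- zeros, so only their values are identified.
  eval-unique : ∀ M p w → (∀ m → M ≤ m → evalℕ m p ≡ evalℕ m w) → eval p ≈ eval w
  eval-unique M []      []      eq = refl
  eval-unique M (a ∷ p) (b ∷ w) eq = +-cong
    (reflexive (≡.cong (_· 1#) (evalℕ-head M a b p w eq)))
    (*-congˡ (eval-unique (suc M) p w (evalℕ-tail M a b p w eq)))
  eval-unique M []      (b ∷ w) eq = trans
    (sym (trans (+-identityˡ _) (zeroʳ x)))
    (+-cong (reflexive (≡.cong (_· 1#) (evalℕ-head M 0 b [] w eq′)))
            (*-congˡ (eval-unique (suc M) [] w (evalℕ-tail M 0 b [] w eq′))))
    where
    eq′ : ∀ m → M ≤ m → m ℕ.* 0 ≡ b ℕ.+ m ℕ.* evalℕ m w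
    eq′ m M≤m = ≡.trans (ℕ.*-zeroʳ m) (eq m M≤m)
  eval-unique M (a ∷ p) []      eq = trans
    (+-cong (reflexive (≡.cong (_· 1#) (evalℕ-head M a 0 p [] eq′)))
            (*-congˡ (eval-unique (suc M) p [] (evalℕ-tail M a 0 p [] eq′))))
    (trans (+-identityˡ _) (zeroʳ x))
    where
    eq′ : ∀ m → M ≤ m → a ℕ.+ m ℕ.* evalℕ m p ≡ m ℕ.* 0
    eq′ m M≤m = ≡.trans (eq m M≤m) (≡.sym (ℕ.*-zeroʳ m))

module SamePolynomial {c₁ ℓ₁ c₂ ℓ₂} (A : CommutativeRing c₁ ℓ₁) (B : CommutativeRing c₂ ℓ₂)
  (q : CommutativeRing.Carrier A) (q′ : CommutativeRing.Carrier B) where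
  private
    module A = CommutativeRing A
    module B = CommutativeRing B
    module EA = Evaluation A q
    module EB = Evaluation B q′

  _~_ : A.Carrier → B.Carrier → Set (ℓ₁ ⊔ ℓ₂)
  x ~ y = ∃[ pw ] EA.Represents pw x × EB.Represents pw y

  relation : RingRelation A.rawRing B.rawRing _~_
  relation = record
    { 0~ = _ , EA.represents-0 , EB.represents-0
    ; 1~ = _ , EA.represents-1 , EB.represents-1
    ; +~ = λ (_ , x , x′) (_ , y , y′) → _ , EA.represents-+ x y , EB.represents-+ x′ y′
    ; *~ = λ (_ , x , x′) (_ , y , y′) → _ , EA.represents-* x y , EB.represents-* x′ y′
    ; -~ = λ (_ , x , x′) → _ , EA.represents-neg x , EB.represents-neg x′
    }

  q~q′ : q ~ q′
  q~q′ = _ , EA.represents-x , EB.represents-x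

  difference~ : ∀ {x y x′ y′} → x ~ x′ → y ~ y′ → (x A.- y) ~ (x′ B.- y′)
  difference~ x~x′ y~y′ = +~ x~x′ (-~ y~y′)
    where open RingRelation relation

-- Specialisation of q to 2, 3, 4, ... over ℚ.

ℚ-ring : CommutativeRing _ _
ℚ-ring = ℚ.+-*-commutativeRing

module ℚ-Lemmas = RingLemmas ℚ-ring

module _ where
  open ℚ-Lemmas using (_^_)
  open Algebra.Properties.Semiring.Mult (CommutativeRing.semiring ℚ-ring) renaming (_×_ to _·_) using (×-homo-+; ×1-homo-*)

  fromℕ : ℕ → ℚ
  fromℕ n = n · 1ℚ

  fromℕ-nonneg : ∀ n → 0ℚ ℚ.≤ fromℕ n
  fromℕ-nonneg zero    = ℚ.≤-refl
  fromℕ-nonneg (suc n) = ℚ.+-mono-≤ (ℚ.<⇒≤ (ℚ.positive⁻¹ 1ℚ)) (fromℕ-nonneg n)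

  fromℕ-suc≢0 : ∀ n → fromℕ (suc n) ≢ 0ℚ
  fromℕ-suc≢0 n eq = ℚ.<⇒≢ (ℚ.+-mono-<-≤ (ℚ.positive⁻¹ 1ℚ) (fromℕ-nonneg n)) (≡.sym eq)

  fromℕ-injective : ∀ m n → fromℕ m ≡ fromℕ n → m ≡ n
  fromℕ-injective zero    zero    eq = ≡.refl
  fromℕ-injective zero    (suc n) eq = ⊥-elim (fromℕ-suc≢0 n (≡.sym eq))
  fromℕ-injective (suc m) zero    eq = ⊥-elim (fromℕ-suc≢0 m eq)
  fromℕ-injective (suc m) (suc n) eq = ≡.cong suc (fromℕ-injective m n (ℚ-Lemmas.+-cancelˡ 1ℚ (fromℕ m) (fromℕ n) eq))

  fromℕ-^ : ∀ m e → fromℕ m ^ e ≡ fromℕ (m ℕ.^ e)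
  fromℕ-^ m zero    = ≡.sym (ℚ.+-identityʳ 1ℚ)
  fromℕ-^ m (suc e) = ≡.trans (≡.cong (ℚ._*_ (fromℕ m)) (fromℕ-^ m e)) (≡.sym (×1-homo-* m (m ℕ.^ e)))

  fromℕ-eval : ∀ m p → Evaluation.eval ℚ-ring (fromℕ m) p ≡ fromℕ (evalℕ m p)
  fromℕ-eval m []      = ≡.refl
  fromℕ-eval m (a ∷ p) = ≡.trans
    (≡.cong (λ y → fromℕ a ℚ.+ y) (≡.trans (≡.cong (ℚ._*_ (fromℕ m)) (fromℕ-eval m p)) (≡.sym (×1-homo-* m (evalℕ m p)))))
    (≡.sym (×-homo-+ 1ℚ a (m ℕ.* evalℕ m p)))

  ℚ-unit : ∀ y → y ≢ 0ℚ → Σ ℚ λ z → y ℚ.* z ≡ 1ℚ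
  ℚ-unit y y≢0 = (ℚ.1/ y) ⦃ ℚ.≢-nonZero y≢0 ⦄ , ℚ.*-inverseʳ y ⦃ ℚ.≢-nonZero y≢0 ⦄

  -- A positive power of a natural number that is at least 2 exceeds 1, and the natural numbers
  -- embed in ℚ.
  1-fromℕ^≢0 : ∀ m e → 1ℚ ℚ.- fromℕ (2 ℕ.+ m) ^ suc e ≢ 0ℚ
  1-fromℕ^≢0 m e eq = ℕ.<⇒≢ (ℕ.≤-trans (s≤s (s≤s z≤n)) (ℕ.m≤m*n (2 ℕ.+ m) ((2 ℕ.+ m) ℕ.^ e) ⦃ ℕ.m^n≢0 (2 ℕ.+ m) e ⦄))
    (fromℕ-injective 1 ((2 ℕ.+ m) ℕ.^ suc e) (≡.trans (ℚ.+-identityʳ 1ℚ)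
      (≡.trans (ℚ-Lemmas.x-y≈0⇒x≈y 1ℚ (fromℕ (2 ℕ.+ m) ^ suc e) eq) (fromℕ-^ (2 ℕ.+ m) (suc e)))))

-- q is specialised simultaneously to all the integers 2, 3, 4, …
ℚ^ℕ : CommutativeRing _ _
ℚ^ℕ = Algebra.Construct.Pointwise.commutativeRing ℕ ℚ-ring

𝐪 : ℕ → ℚ
𝐪 m = fromℕ (2 ℕ.+ m)

module ℚ^ℕ-Lemmas = RingLemmas ℚ^ℕ

𝐪-generic : IsGeneric ℚ^ℕ 𝐪
𝐪-generic = record
  { r    = λ m → proj₁ (q-unit m)
  ; qr≈1 = λ m → proj₂ (q-unit m)
  ; 1-q^ = λ e → (λ m → proj₁ (1-q^-unit m e)) , λ m → ≡.trans
      (≡.cong (λ y → (1ℚ ℚ.- y) ℚ.* proj₁ (1-q^-unit m e)) (^-pointwise m (suc e)))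
      (proj₂ (1-q^-unit m e))
  }
  where
  q-unit : ∀ m → Σ ℚ λ z → 𝐪 m ℚ.* z ≡ 1ℚ
  q-unit m = ℚ-unit (𝐪 m) (fromℕ-suc≢0 (suc m))
  1-q^-unit : ∀ m e → Σ ℚ λ z → (1ℚ ℚ.- 𝐪 m ℚ-Lemmas.^ suc e) ℚ.* z ≡ 1ℚ
  1-q^-unit m e = ℚ-unit _ (1-fromℕ^≢0 m e)
  ^-pointwise : ∀ m n → (𝐪 ℚ^ℕ-Lemmas.^ n) m ≡ 𝐪 m ℚ-Lemmas.^ n
  ^-pointwise m zero    = ≡.refl
  ^-pointwise m (suc n) = ≡.cong (ℚ._*_ (𝐪 m)) (^-pointwise m n)

eval-pointwise : ∀ p m → Evaluation.eval ℚ^ℕ 𝐪 p m ≡ fromℕ (evalℕ (2 ℕ.+ m) p)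
eval-pointwise p m = ≡.trans (go p) (fromℕ-eval (2 ℕ.+ m) p)
  where
  module E = Evaluation ℚ^ℕ 𝐪
  module Eₘ = Evaluation ℚ-ring (𝐪 m)
  multiple : ∀ a → (a E.· CommutativeRing.1# ℚ^ℕ) m ≡ a Eₘ.· 1ℚ
  multiple zero    = ≡.refl
  multiple (suc a) = ≡.cong (ℚ._+_ 1ℚ) (multiple a)
  go : ∀ p → E.eval p m ≡ Eₘ.eval p
  go []      = ≡.refl
  go (a ∷ p) = ≡.cong₂ (λ y z → y ℚ.+ 𝐪 m ℚ.* z) (multiple a) (go p)

module Specialisation {c ℓ} (R : CommutativeRing c ℓ) (q : CommutativeRing.Carrier R) where
  private
    module R = CommutativeRing R
    module Q = CommutativeRing ℚ^ℕ
    module ER = Evaluation R q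
    module EQ = Evaluation ℚ^ℕ 𝐪

  open SamePolynomial R ℚ^ℕ q 𝐪 public

  -- If p - w represents both elements, then f = 0 says that p and w agree at every integer from 2
  -- on. They then have the same coefficients up to trailing zeros, hence the same value at q.
  ~0⇒≈0 : ∀ {x f} → x ~ f → f Q.≈ Q.0# → x R.≈ R.0#
  ~0⇒≈0 {x} {f} ((p , w) , ER.represents x~ , EQ.represents f~) f≈0 =
    RingLemmas.+-cancelʳ R (ER.eval w) x R.0# (R.trans x~ (R.trans (eval-unique R q 2 p w agree) (R.sym (R.+-identityˡ _))))
    where
    agree : ∀ m → 2 ≤ m → evalℕ m p ≡ evalℕ m w
    agree (suc (suc m)) _ = fromℕ-injective _ _ (≡.trans (≡.sym (eval-pointwise p m)) (≡.trans (≡.sym (f~ m))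
      (≡.trans (≡.cong (ℚ._+ EQ.eval w m) (f≈0 m)) (≡.trans (ℚ.+-identityˡ _) (eval-pointwise w m)))))
    agree (suc zero) (s≤s ())

  transfer : ∀ {x y f g} → x ~ f → y ~ g → f Q.≈ g → x R.≈ y
  transfer {x} {y} {f} {g} x~f y~g f≈g = RingLemmas.x-y≈0⇒x≈y R x y (~0⇒≈0 {x R.- y} {f Q.- g} (difference~ {x} {y} {f} {g} x~f y~g)
    (Q.trans {f Q.- g} {g Q.- g} {Q.0#} (Q.+-cong {f} {g} {Q.- g} {Q.- g} f≈g (Q.refl {Q.- g})) (Q.-‿inverseʳ g)))

open import Data.Nat.Base using (_+_)

-- The theorem over an arbitrary commutative ring.

module Assembly {c ℓ} (R : CommutativeRing c ℓ) (q : CommutativeRing.Carrier R) {s : ℕ}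
  (β : Fin s → ℕ) (β>0 : ∀ i → 1 ≤ β i) where
  open CommutativeRing R using (refl; trans; *-congˡ; *-congʳ; *-identityʳ; *-assoc)
  open RingNotation R
  open Laurent R s
  open Expansion R q s β
  open Weights β
  open Specialisation R q
  private
    module G = GenericCase ℚ^ℕ 𝐪-generic β β>0
    module T = Transfer R ℚ^ℕ relation s
    module RL = RingLemmas R
    module EQ = Expansion ℚ^ℕ 𝐪 s β

  vanishes : ∀ {n} → Fin s → ∀ k → (∀ i → lookup k i ℤ.< + n) → [z^ k /w^ n ]F ≈ 0#
  vanishes {n} a k k<n = ~0⇒≈0 {[z^ k /w^ n ]F} {EQ.[z^ k /w^ n ]F} (T.F~ {q} {𝐪} q~q′ β k n) (G.F-vanishes a k k<n)

  -- Only integer polynomials in q can be transferred, so the denominator stays on the left until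
  -- `divide` removes it.
  powerCoefficient : ∀ {n} → 1 ≤ n → ∀ a →
    [z^ power a (+ n) /w^ n ]F * product (λ i → ⟨ q ︔ q ⟩ β i) ≈
    q ^ tailSum a * ((1# - q ^ β a) * (⟨ q ︔ q ⟩ (∣β∣ ∸ β a))) * (⟨ q ^ (∣β∣ ∸ β a + n + 1) ︔ q ⟩ (β a ∸ 1))
  powerCoefficient {n} 1≤n a = transfer
    (T.F*denominator~ {q} {𝐪} q~q′ β (power a (+ n)) n) (T.numerator~ {q} {𝐪} q~q′ β a (∣β∣ ∸ β a + n + 1)) (G.F-power 1≤n a)

  divide : ∀ {x t y z d} → x * d ≈ t * y * z → (unit : IsUnit d) → x ≈ t * (y ÷ d [ unit ]) * z
  divide {x} {t} {y} {z} {d} eq (d⁻¹ , _ , dd⁻¹≈1) = RL.begin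
    x                      RL.≈⟨ trans (*-congˡ dd⁻¹≈1) (*-identityʳ x) ⟨
    x * (d * d⁻¹)          RL.≈⟨ *-assoc x d d⁻¹ ⟨
    x * d * d⁻¹            RL.≈⟨ *-congʳ eq ⟩
    t * y * z * d⁻¹        RL.≈⟨ RL.solve 4 (λ t y z i → t RL.:* y RL.:* z RL.:* i RL.:= t RL.:* (y RL.:* i) RL.:* z) refl t y z d⁻¹ ⟩
    t * (y * d⁻¹) * z      RL.∎

theorem4p5 :
    ∀ {c ℓ} (R : CommutativeRing c ℓ) (q : CommutativeRing.Carrier R)
      (s : ℕ) → 1 ≤ s →
      (β : Fin s → ℕ) → (∀ i → 1 ≤ β i) →
      (n : ℕ) → 1 ≤ n →
      let open RingNotation R
          open Laurent R s
          open Expansion R q s β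
          open Weights β
          denominator = product (λ i → ⟨ q ︔ q ⟩ β i)
      in
      ((k : Exponent) → (∀ i → lookup k i ℤ.< + n) → [z^ k /w^ n ]F ≈ 0#)
      ×
      ((unit : IsUnit denominator) (a : Fin s) →
        [z^ power a (+ n) /w^ n ]F
          ≈ q ^ tailSum a
            * (((1# - q ^ β a) * (⟨ q ︔ q ⟩ (∣β∣ ∸ β a))) ÷ denominator [ unit ])
            * (⟨ q ^ (∣β∣ ∸ β a + n + 1) ︔ q ⟩ (β a ∸ 1)))
theorem4p5 R q s 1≤s β β>0 n 1≤n =
    -- Partial fractions require a node, and s ≥ 1 provides a variable for it.
    (λ k k<n → vanishes (Fin.fromℕ< 1≤s) k k<n)
  , (λ unit a → divide (powerCoefficient 1≤n a) unit)
  where open Assembly R q β β>0
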